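{- Every standard multigraph $M$ on $n$ vertices with $\delta(M)\geq\frac{4n-3}{3}$ contains $\lfloor\frac{n}{3}\rfloor$ pairwise vertex-disjoint $4$-triangles.
   Context: Multigraphs have no loops; $\mu(x,y)$ is the number of edges with ends $x,y$; $M$ is standard if $\mu(x,y)\le2$ for all $x,y$; $d(x)=\sum_y\mu(x,y)$ and $\delta(M)=\min_x d(x)$. A $4$-triangle is a multigraph on three vertices containing a triangle $C_3$ and having exactly $4$ edges counted with multiplicity; $M$ contains a $4$-triangle on $\{x,y,z\}$ iff $x,y,z$ are pairwise adjacent and $\mu(x,y)+\mu(y,z)+\mu(x,z)\ge4$. -}

module Defs where

open import Data.Nat using (ℕ; _+_; _*_; _∸_; _≤_; _≥_; _<_)
open import Data.Fin using (Fin)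
open import Data.Fin.Properties using ()
open import Data.Vec.Functional using (Vector)
open import Data.Vec.Functional as VF using ()
open import Data.Fin.Base using (_↑ˡ_)
open import Data.Product using (_×_; Σ; _,_)
open import Data.List using (List; length; concatMap; _∷_; [])
open import Data.List.Relation.Unary.All using (All)
open import Data.List.Relation.Unary.AllPairs using (AllPairs)
open import Relation.Binary.PropositionalEquality using (_≡_; _≢_)
import Data.Nat.Base as ℕ

-- A loopless multigraph on vertex set Fin n, given by its edge-multiplicity
-- function μ (μ x y = number of edges with ends x, y).
record Multigraph (n : ℕ) : Set where
  field
    μ       : Fin n → Fin n → ℕ
    μ-sym   : ∀ x y → μ x y ≡ μ y x
    μ-loop  : ∀ x → μ x x ≡ 0

open Multigraph public

Standard : ∀ {n} → Multigraph n → Set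
Standard {n} M = ∀ (x y : Fin n) → μ M x y ≤ 2

degree : ∀ {n} → Multigraph n → Fin n → ℕ
degree {n} M x = Data.Vec.Functional.foldr _+_ 0 (λ y → μ M x y)

Adjacent : ∀ {n} → Multigraph n → Fin n → Fin n → Set
Adjacent M x y = 1 ≤ μ M x y

-- M contains a 4-triangle on {x,y,z}: pairwise adjacent and total
-- multiplicity ≥ 4 (adjacency forces x,y,z distinct since there are no loops).
FourTriangle : ∀ {n} → Multigraph n → Fin n → Fin n → Fin n → Set
FourTriangle M x y z =
  Adjacent M x y × Adjacent M y z × Adjacent M x z ×
  4 ≤ μ M x y + μ M y z + μ M x z

Triple : ℕ → Set
Triple n = Fin n × Fin n × Fin n

verts : ∀ {n} → Triple n → List (Fin n)
verts (x , y , z) = x ∷ y ∷ z ∷ []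

DisjointFourTriangles : ∀ {n} → Multigraph n → List (Triple n) → Set
DisjointFourTriangles M ts =
  All (λ { (x , y , z) → FourTriangle M x y z }) ts ×
  AllPairs _≢_ (concatMap verts ts)

{-# OPTIONS --safe #-}
module Submission where

-- For n = 3k a triangle factor of the underlying simple graph exists by Hajnal–Szemerédi,
-- applied with classes of size 3 to the complement; we follow the proof of Kierstead and
-- Kostochka. If some triangle A of the factor has multiplicity sum 3, then by the degree
-- condition at least 13 edges join it to another triangle B of the factor, and exchanging
-- suitable vertices turns A and B into two 4-triangles, so the number of 4-triangles can
-- be increased. For n = 3k + 1 a vertex is deleted; for n = 3k + 2 a vertex joined to all
-- others by double edges is added, and the 4-triangle containing it is dropped.

open import Defs
open import Data.Nat using (ℕ; zero; suc; _+_; _*_; _∸_; _≤_; _<_; _/_; z≤n; s≤s; s≤s⁻¹; _≟_; _≤?_)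
open import Data.Nat.Properties
open import Data.Nat.Tactic.RingSolver using (solve-∀)
open import Data.Bool using (Bool; true; false; _∧_; _∨_; not; if_then_else_)
open import Data.Bool.Properties using (∧-comm; ∧-identityʳ; ∧-zeroʳ; ¬-not) renaming (_≟_ to _≟ᵇ_)
open import Data.Fin using (Fin; zero; suc; punchIn; toℕ)
open import Data.Nat.DivMod using (DivMod; _divMod_; _mod_)
import Data.Fin.Properties as Fin
open import Data.Product using (Σ; _×_; _,_; proj₁; proj₂; ∃; ∃₂)
open import Data.Sum using (_⊎_; inj₁; inj₂)
open import Data.List using (List; length; []; _∷_; allFin; tabulate)
open import Data.List.Properties using (length-tabulate)
open import Data.List.Relation.Unary.All using ([]; _∷_)
import Data.List.Relation.Unary.All as All
import Data.List.Relation.Unary.All.Properties as All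
open import Data.List.Relation.Unary.AllPairs using (AllPairs; []; _∷_)
import Data.List.Relation.Unary.AllPairs.Properties as AllPairs
open import Data.List.Relation.Unary.Any using (here; there)
open import Data.List.Membership.Propositional using (_∈_; _∉_)
open import Data.List.Membership.Propositional.Properties using (∈-allFin)
import Data.List.Membership.DecPropositional as DecMembership
open import Data.Maybe using (Maybe; just; nothing; is-just; maybe′)
open import Data.Maybe.Properties using (just-injective) renaming (≡-dec to Maybe-≡-dec)
open import Data.Unit using (⊤; tt)
open import Data.Empty using (⊥; ⊥-elim)
open import Induction.WellFounded using (Acc; acc)
open import Data.Nat.Induction using (<-wellFounded)
open import Function using (_∘_; const)
open import Relation.Nullary using (¬_; Dec; yes; no; does; contradiction)
open import Relation.Nullary.Decidable using (dec-true; dec-false; map′; ¬?; _×-dec_; decidable-stable)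
open import Relation.Binary.PropositionalEquality
open import Algebra.Properties.Semiring.Sum +-*-semiring
  using (sum; sum-cong-≗; ∑-distrib-+; ∑-comm; *-distribˡ-sum; *-distribʳ-sum)

-- In the colouring theorem one vertex `w` is uncoloured and one class `c₀` has a hole. Call a class
-- accessible if vertices can be shifted from it, class by class, into the hole; `w` can be placed
-- once it has no neighbour in some accessible class. The obstacle is a `w` with neighbours in all
-- of them. Then `w` and the vertices of the inaccessible classes form a set `B` in which every
-- vertex spends a neighbour on each accessible class, so degrees inside `B` are small, and `B`
-- without any one vertex `y` can be recoloured with the inaccessible colours by induction on the
-- number of colours. This frees `y` to enter an accessible class `W` in place of its only neighbour
-- `z` there. Changing `W` must not cut off the other accessible classes, hence the search for
-- terminal classes. Either `z` can now be placed, or counting yields two non-adjacent candidates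
-- `y` with the same `z`, and the swap makes a further class accessible.

private variable
  n K : ℕ

-- Finite sums and counting

𝟙 : Bool → ℕ
𝟙 true  = 1
𝟙 false = 0

𝟙≤1 : ∀ b → 𝟙 b ≤ 1
𝟙≤1 true  = ≤-refl
𝟙≤1 false = z≤n

does⇒ : ∀ {A : Set} (a? : Dec A) → does a? ≡ true → A
does⇒ (yes a) _ = a

true≢false : ∀ {b} → b ≡ true → b ≢ false
true≢false refl ()

sum-mono-≤ : ∀ {f g : Fin n → ℕ} → (∀ i → f i ≤ g i) → sum f ≤ sum g
sum-mono-≤ {zero}  f≤g = z≤n
sum-mono-≤ {suc n} f≤g = +-mono-≤ (f≤g zero) (sum-mono-≤ (f≤g ∘ suc))

sum-zero : ∀ {f : Fin n → ℕ} → (∀ i → f i ≡ 0) → sum f ≡ 0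
sum-zero {zero}  _   = refl
sum-zero {suc n} f≡0 = cong₂ _+_ (f≡0 zero) (sum-zero (f≡0 ∘ suc))

sum-const : ∀ n c → sum {n} (const c) ≡ n * c
sum-const zero    c = refl
sum-const (suc n) c = cong (c +_) (sum-const n c)

term≤sum : ∀ (f : Fin n → ℕ) i → f i ≤ sum f
term≤sum f zero    = m≤m+n _ _
term≤sum f (suc i) = ≤-trans (term≤sum (f ∘ suc) i) (m≤n+m _ _)

two-terms≤sum : ∀ (f : Fin n → ℕ) {i j} → i ≢ j → f i + f j ≤ sum f
two-terms≤sum f {zero}  {zero}  i≢j = contradiction refl i≢j
two-terms≤sum f {zero}  {suc j} i≢j = +-monoʳ-≤ (f zero) (term≤sum (f ∘ suc) j)
two-terms≤sum f {suc i} {zero}  i≢j =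
  ≤-trans (≤-reflexive (+-comm (f (suc i)) (f zero))) (+-monoʳ-≤ (f zero) (term≤sum (f ∘ suc) i))
two-terms≤sum f {suc i} {suc j} i≢j =
  ≤-trans (two-terms≤sum (f ∘ suc) (i≢j ∘ cong suc)) (m≤n+m _ _)

sum<⇒∃< : ∀ (f g : Fin n → ℕ) → sum g < sum f → ∃ λ i → g i < f i
sum<⇒∃< {suc n} f g lt with suc (g zero) ≤? f zero
... | yes g<f = zero , g<f
... | no  g≮f with i , gi<fi ← sum<⇒∃< (f ∘ suc) (g ∘ suc)
                (+-cancelˡ-< (f zero) _ _ (≤-<-trans (+-monoˡ-≤ _ (≮⇒≥ g≮f)) lt)) = suc i , gi<fi

-- The two corrections are added on opposite sides because subtraction of naturals truncates.
sum-differ : ∀ (f g : Fin n → ℕ) v → (∀ u → u ≢ v → f u ≡ g u) → sum f + g v ≡ sum g + f v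
sum-differ f g zero eq =
  trans (cong (λ t → f zero + t + g zero) (sum-cong-≗ (λ i → eq (suc i) λ ())))
        (swap (f zero) (g zero) (sum (g ∘ suc)))
  where
  swap : ∀ a b t → a + t + b ≡ b + t + a
  swap = solve-∀
sum-differ f g (suc v) eq = begin
  f zero + sum (f ∘ suc) + g (suc v)    ≡⟨ +-assoc (f zero) _ _ ⟩
  f zero + (sum (f ∘ suc) + g (suc v))  ≡⟨ cong₂ _+_ (eq zero λ ())
                                             (sum-differ (f ∘ suc) (g ∘ suc) v (λ u u≢v → eq (suc u) (u≢v ∘ Fin.suc-injective))) ⟩
  g zero + (sum (g ∘ suc) + f (suc v))  ≡⟨ +-assoc (g zero) _ _ ⟨
  g zero + sum (g ∘ suc) + f (suc v)    ∎
  where open ≡-Reasoning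

sum-single : ∀ (f : Fin n → ℕ) v → (∀ u → u ≢ v → f u ≡ 0) → sum f ≡ f v
sum-single {n} f v eq = begin
  sum f                ≡⟨ +-identityʳ _ ⟨
  sum f + 0            ≡⟨ sum-differ f (const 0) v eq ⟩
  sum {n} (const 0) + f v  ≡⟨ cong (_+ f v) (sum-zero {n} {f = const 0} (λ _ → refl)) ⟩
  f v                  ∎
  where open ≡-Reasoning

count : (Fin n → Bool) → ℕ
count P = sum (𝟙 ∘ P)

Σ⟨_⟩ : (Fin n → Bool) → (Fin n → ℕ) → ℕ
Σ⟨ P ⟩ f = sum (λ i → 𝟙 (P i) * f i)

sum-mono-< : ∀ {f g : Fin n → ℕ} i → (∀ j → f j ≤ g j) → f i < g i → sum f < sum g
sum-mono-< zero    f≤g fi<gi = +-mono-<-≤ fi<gi (sum-mono-≤ (f≤g ∘ suc))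
sum-mono-< (suc i) f≤g fi<gi = +-mono-≤-< (f≤g zero) (sum-mono-< i (f≤g ∘ suc) fi<gi)

count-< : ∀ {P Q : Fin n → Bool} {x} → (∀ i → P i ≡ true → Q i ≡ true) →
          P x ≡ false → Q x ≡ true → count P < count Q
count-< {P = P} {Q} {x} P⊆Q Px Qx = sum-mono-< x le lt
  where
  lt : 𝟙 (P x) < 𝟙 (Q x)
  lt rewrite Px | Qx = ≤-refl
  le : ∀ i → 𝟙 (P i) ≤ 𝟙 (Q i)
  le i with P i in Pi
  ... | false = z≤n
  ... | true  = ≤-reflexive (cong 𝟙 (sym (P⊆Q i Pi)))

sum-+ : ∀ (f g : Fin n → ℕ) → sum (λ i → f i + g i) ≡ sum f + sum g
sum-+ = ∑-distrib-+

sum-at : ∀ (f : Fin n → ℕ) v → sum (λ u → 𝟙 (does (u Fin.≟ v)) * f u) ≡ f v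
sum-at f v = trans (sum-single _ v (λ u u≢v → cong (λ b → 𝟙 b * f u) (dec-false (u Fin.≟ v) u≢v)))
  (trans (cong (λ b → 𝟙 b * f v) (dec-true (v Fin.≟ v) refl)) (*-identityˡ (f v)))

count-at : ∀ (v : Fin n) → count (λ u → does (u Fin.≟ v)) ≡ 1
count-at v = trans (sum-single _ v (λ u u≢v → cong 𝟙 (dec-false (u Fin.≟ v) u≢v)))
  (cong 𝟙 (dec-true (v Fin.≟ v) refl))

-- Equitable colourings

Colouring : ℕ → ℕ → Set
Colouring n K = Fin n → Maybe (Fin K)

_≟ᶜ_ : (x y : Maybe (Fin K)) → Dec (x ≡ y)
_≟ᶜ_ = Maybe-≡-dec Fin._≟_

just≢nothing : ∀ {x : Maybe (Fin K)} {c} → x ≡ just c → x ≢ nothing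
just≢nothing refl ()

is-just-false : ∀ {x : Maybe (Fin K)} → is-just x ≡ false → x ≡ nothing
is-just-false {x = nothing} _ = refl

is-just-true : ∀ {x : Maybe (Fin K)} → is-just x ≡ true → ∃ λ c → x ≡ just c
is-just-true {x = just c} _ = c , refl

colour-unique : ∀ {x : Maybe (Fin K)} {c d} → x ≡ just c → x ≡ just d → c ≡ d
colour-unique p q = just-injective (trans (sym p) q)

class : Colouring n K → Fin K → Fin n → Bool
class F c v = does (F v ≟ᶜ just c)

class-true : ∀ (F : Colouring n K) {c v} → F v ≡ just c → class F c v ≡ true
class-true F = dec-true (_ ≟ᶜ _)

class-false : ∀ (F : Colouring n K) {c v} → F v ≢ just c → class F c v ≡ false
class-false F = dec-false (_ ≟ᶜ _)

class-true⁻ : ∀ (F : Colouring n K) {c v} → class F c v ≡ true → F v ≡ just c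
class-true⁻ F = does⇒ (_ ≟ᶜ _)

size : Colouring n K → Fin K → ℕ
size F c = count (class F c)

-- Double counting: after exchanging the sums, each `v` meets only the class of its own colour, and
-- uncoloured vertices contribute 0. With `φ` constant this counts vertices, with `φ` an adjacency
-- indicator it splits a degree by classes.
∑-classes : ∀ (F : Colouring n K) (g : Fin K → ℕ) (φ : Fin n → ℕ) →
            sum (λ c → g c * Σ⟨ class F c ⟩ φ) ≡ sum (λ v → maybe′ g 0 (F v) * φ v)
∑-classes F g φ = begin
  sum (λ c → g c * Σ⟨ class F c ⟩ φ)
    ≡⟨ sum-cong-≗ (λ c → *-distribˡ-sum (g c) (λ v → 𝟙 (class F c v) * φ v)) ⟩
  sum (λ c → sum (λ v → g c * (𝟙 (class F c v) * φ v)))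
    ≡⟨ ∑-comm (λ c v → g c * (𝟙 (class F c v) * φ v)) ⟩
  sum (λ v → sum (λ c → g c * (𝟙 (class F c v) * φ v)))
    ≡⟨ sum-cong-≗ pointwise ⟩
  sum (λ v → maybe′ g 0 (F v) * φ v) ∎
  where
  open ≡-Reasoning
  vanish : ∀ {c v} → F v ≢ just c → g c * (𝟙 (class F c v) * φ v) ≡ 0
  vanish {c} Fv≢c rewrite class-false F Fv≢c = *-zeroʳ (g c)
  pointwise : ∀ v → sum (λ c → g c * (𝟙 (class F c v) * φ v)) ≡ maybe′ g 0 (F v) * φ v
  pointwise v with F v in eq
  ... | nothing = sum-zero (λ c → subst (λ x → g c * (𝟙 (does (x ≟ᶜ just c)) * φ v) ≡ 0) eq
                             (vanish λ Fv≡c → just≢nothing Fv≡c eq))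
  ... | just c₀ = trans (sum-single _ c₀ (λ c c≢c₀ →
                    subst (λ x → g c * (𝟙 (does (x ≟ᶜ just c)) * φ v) ≡ 0) eq
                      (vanish λ Fv≡c → c≢c₀ (colour-unique Fv≡c eq))))
                    (trans (cong (λ b → g c₀ * (𝟙 b * φ v)) (dec-true (just c₀ ≟ᶜ just c₀) refl))
                      (cong (g c₀ *_) (+-identityʳ (φ v))))

_[_≔_] : {A : Set} → (Fin n → A) → Fin n → A → Fin n → A
(F [ v ≔ x ]) u = if does (u Fin.≟ v) then x else F u

≔-same : ∀ {A : Set} (F : Fin n → A) v {x} → (F [ v ≔ x ]) v ≡ x
≔-same F v rewrite dec-true (v Fin.≟ v) refl = refl

≔-other : ∀ {A : Set} (F : Fin n → A) {v x u} → u ≢ v → (F [ v ≔ x ]) u ≡ F u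
≔-other F {v} {u = u} u≢v rewrite dec-false (u Fin.≟ v) u≢v = refl

size-differ : ∀ (F F′ : Colouring n K) v c → (∀ u → u ≢ v → F u ≡ F′ u) →
              size F c + 𝟙 (class F′ c v) ≡ size F′ c + 𝟙 (class F c v)
size-differ F F′ v c eq = sum-differ _ _ v λ u u≢v → cong (λ x → 𝟙 (does (x ≟ᶜ just c))) (eq u u≢v)

size-≔-just : ∀ (F : Colouring n K) {v} c → F v ≡ nothing → size (F [ v ≔ just c ]) c ≡ suc (size F c)
size-≔-just F {v} c Fv = begin
  size F′ c                      ≡⟨ +-identityʳ _ ⟨
  size F′ c + 0                  ≡⟨ cong (λ b → size F′ c + 𝟙 b) (class-false F (λ p → just≢nothing p Fv)) ⟨
  size F′ c + 𝟙 (class F c v)    ≡⟨ size-differ F F′ v c (λ u u≢v → sym (≔-other F u≢v)) ⟨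
  size F c + 𝟙 (class F′ c v)    ≡⟨ cong (λ b → size F c + 𝟙 b) (class-true F′ (≔-same F v)) ⟩
  size F c + 1                   ≡⟨ +-comm _ 1 ⟩
  suc (size F c)                 ∎
  where
  open ≡-Reasoning
  F′ = F [ v ≔ just c ]

size-≔-nothing : ∀ (F : Colouring n K) {v} c → F v ≡ just c → suc (size (F [ v ≔ nothing ]) c) ≡ size F c
size-≔-nothing F {v} c Fv = begin
  suc (size F′ c)                ≡⟨ +-comm 1 _ ⟩
  size F′ c + 1                  ≡⟨ cong (λ b → size F′ c + 𝟙 b) (class-true F Fv) ⟨
  size F′ c + 𝟙 (class F c v)    ≡⟨ size-differ F F′ v c (λ u u≢v → sym (≔-other F u≢v)) ⟨
  size F c + 𝟙 (class F′ c v)    ≡⟨ cong (λ b → size F c + 𝟙 b) (class-false F′ (λ p → just≢nothing p (≔-same F v))) ⟩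
  size F c + 0                   ≡⟨ +-identityʳ _ ⟩
  size F c                       ∎
  where
  open ≡-Reasoning
  F′ = F [ v ≔ nothing ]

size-≔-other : ∀ (F : Colouring n K) {v x} c → F v ≢ just c → x ≢ just c → size (F [ v ≔ x ]) c ≡ size F c
size-≔-other F {v} {x} c Fv x≢c = begin
  size F′ c                      ≡⟨ +-identityʳ _ ⟨
  size F′ c + 0                  ≡⟨ cong (λ b → size F′ c + 𝟙 b) (class-false F Fv) ⟨
  size F′ c + 𝟙 (class F c v)    ≡⟨ size-differ F F′ v c (λ u u≢v → sym (≔-other F u≢v)) ⟨
  size F c + 𝟙 (class F′ c v)    ≡⟨ cong (λ b → size F c + 𝟙 b) (class-false F′ (λ p → x≢c (trans (sym (≔-same F v)) p))) ⟩
  size F c + 0                   ≡⟨ +-identityʳ _ ⟩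
  size F c                       ∎
  where
  open ≡-Reasoning
  F′ = F [ v ≔ x ]

-- Graphs and degrees into colour classes

record Graph (n : ℕ) : Set where
  field
    edge    : Fin n → Fin n → Bool
    symm    : ∀ u v → edge u v ≡ edge v u
    irrefl  : ∀ v → edge v v ≡ false

open Graph public

deg : Graph n → (Fin n → Bool) → Fin n → ℕ
deg G S v = Σ⟨ S ⟩ (𝟙 ∘ edge G v)

classDeg : Graph n → Colouring n K → Fin K → Fin n → ℕ
classDeg G F c = deg G (class F c)

Proper : Graph n → Colouring n K → Set
Proper G F = ∀ {u v c} → F u ≡ just c → F v ≡ just c → edge G u v ≡ false

-- The class `c` can receive `v`. For coloured `v` these are the arcs of the auxiliary digraph on
-- the classes.
Free : Graph n → Colouring n K → Fin K → Fin n → Set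
Free G F c v = ∀ u → F u ≡ just c → edge G v u ≡ false

deg-≥1 : ∀ (G : Graph n) (S : Fin n → Bool) {u} v → S u ≡ true → edge G v u ≡ true → 1 ≤ deg G S v
deg-≥1 G S {u} v Su e = ≤-trans (≤-reflexive (cong₂ (λ a b → 𝟙 a * 𝟙 b) (sym Su) (sym e)))
  (term≤sum (λ u → 𝟙 (S u) * 𝟙 (edge G v u)) u)

deg≡1⇒unique : ∀ (G : Graph n) (S : Fin n → Bool) {u v x} → deg G S x ≡ 1 → S u ≡ true → S v ≡ true →
               edge G x u ≡ true → u ≢ v → edge G x v ≡ false
deg≡1⇒unique G S {u} {v} {x} d≡1 Su Sv e u≢v with edge G x v in e′
... | false = refl
... | true  = contradiction (≤-trans two (≤-reflexive d≡1)) λ { (s≤s ()) }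
  where
  two : 2 ≤ deg G S x
  two = ≤-trans (≤-reflexive (sym (cong₂ _+_ (cong₂ (λ a b → 𝟙 a * 𝟙 b) Su e) (cong₂ (λ a b → 𝟙 a * 𝟙 b) Sv e′))))
    (two-terms≤sum (λ u → 𝟙 (S u) * 𝟙 (edge G x u)) u≢v)

deg≡0⇒Free : ∀ (G : Graph n) (F : Colouring n K) {c v} → classDeg G F c v ≡ 0 → Free G F c v
deg≡0⇒Free G F {c} {v} d≡0 u Fu with edge G v u in e
... | false = refl
... | true  = contradiction (≤-trans (deg-≥1 G (class F c) v (class-true F Fu) e) (≤-reflexive d≡0)) λ ()

Free⇒deg≡0 : ∀ (G : Graph n) (F : Colouring n K) {c v} → Free G F c v → classDeg G F c v ≡ 0
Free⇒deg≡0 G F {c} {v} free = sum-zero zero-term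
  where
  zero-term : ∀ u → 𝟙 (class F c u) * 𝟙 (edge G v u) ≡ 0
  zero-term u with class F c u in eq
  ... | false = refl
  ... | true  rewrite free u (class-true⁻ F eq) = refl

Free? : ∀ (G : Graph n) (F : Colouring n K) c v → Dec (Free G F c v)
Free? G F c v = map′ (deg≡0⇒Free G F) (Free⇒deg≡0 G F) (classDeg G F c v ≟ 0)

¬Free⇒deg≥1 : ∀ (G : Graph n) (F : Colouring n K) {c v} → ¬ Free G F c v → 1 ≤ classDeg G F c v
¬Free⇒deg≥1 G F ¬free = n≢0⇒n>0 (¬free ∘ deg≡0⇒Free G F)

-- Equitable colourings with a hole, and chains of classes

record Equitable (s : ℕ) (G : Graph n) (S : Fin n → Bool) (C : Fin K → Bool) : Set where
  field
    colour  : Colouring n K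
    domain  : ∀ v → is-just (colour v) ≡ S v
    range   : ∀ {v c} → colour v ≡ just c → C c ≡ true
    proper  : Proper G colour
    sizes   : ∀ c → C c ≡ true → size colour c ≡ s

-- Equitable except that the vertex w is uncoloured and its place in the class c₀ is empty.
record Near (s : ℕ) (G : Graph n) (S : Fin n → Bool) (C : Fin K → Bool)
            (F : Colouring n K) (w : Fin n) (c₀ : Fin K) : Set where
  field
    w∈S     : S w ≡ true
    w-blank : F w ≡ nothing
    domain  : ∀ v → v ≢ w → is-just (F v) ≡ S v
    range   : ∀ {v c} → F v ≡ just c → C c ≡ true
    proper  : Proper G F
    c₀∈C    : C c₀ ≡ true
    size₀   : suc (size F c₀) ≡ s
    sizes   : ∀ c → C c ≡ true → c ≢ c₀ → size F c ≡ s

-- The head of a chain has a vertex that can be moved to a class further down the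
-- chain, so every class of the chain can pass a vertex on towards c₀.
data Chain (G : Graph n) (F : Colouring n K) (c₀ : Fin K) : List (Fin K) → Set where
  start : Chain G F c₀ (c₀ ∷ [])
  step  : ∀ {X Y t L} → Chain G F c₀ L → X ∉ L → F t ≡ just X → Y ∈ L → Free G F Y t →
          Chain G F c₀ (X ∷ L)

Agree : Colouring n K → Colouring n K → Fin K → Set
Agree F F′ c = ∀ v → (F v ≡ just c → F′ v ≡ just c) × (F′ v ≡ just c → F v ≡ just c)

c₀∈chain : ∀ {G : Graph n} {F : Colouring n K} {c₀ L} → Chain G F c₀ L → c₀ ∈ L
c₀∈chain start            = here refl
c₀∈chain (step ch _ _ _ _) = there (c₀∈chain ch)

-- A chain refers only to the classes it lists, so recolouring elsewhere preserves it.
Chain-transport : ∀ {G : Graph n} {F F′ : Colouring n K} {c₀ L} →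
                  (∀ c → c ∈ L → Agree F F′ c) → Chain G F c₀ L → Chain G F′ c₀ L
Chain-transport agree start = start
Chain-transport agree (step ch X∉L Ft Y∈L free) =
  step (Chain-transport (λ c c∈L → agree c (there c∈L)) ch) X∉L (proj₁ (agree _ (here refl) _) Ft) Y∈L
    (λ u F′u → free u (proj₂ (agree _ (there Y∈L) u) F′u))

Proper-≔ : ∀ {G : Graph n} {F : Colouring n K} {w X} → Proper G F → Free G F X w → Proper G (F [ w ≔ just X ])
Proper-≔ {G = G} {F} {w} {X} proper free {u} {v} Fu Fv with u Fin.≟ w | v Fin.≟ w
... | yes refl | yes refl = irrefl G u
... | yes refl | no _     = free v (trans Fv (sym Fu))
... | no _     | yes refl = trans (symm G u v) (free u (trans Fu (sym Fv)))
... | no _     | no _     = proper Fu Fv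

insert : ∀ {s} {G : Graph n} {S C} {F : Colouring n K} {w c₀} →
         Near s G S C F w c₀ → Free G F c₀ w → Equitable s G S C
insert {s = s} {G} {S} {C} {F} {w} {c₀} near free = record
  { colour = F′ ; domain = domain′ ; range = λ {v} → range′ {v}
  ; proper = Proper-≔ {G = G} {F} proper free ; sizes = sizes′ }
  where
  open Near near
  F′ = F [ w ≔ just c₀ ]
  domain′ : ∀ v → is-just (F′ v) ≡ S v
  domain′ v with v Fin.≟ w
  ... | yes refl = sym w∈S
  ... | no v≢w   = domain v v≢w
  range′ : ∀ {v c} → F′ v ≡ just c → C c ≡ true
  range′ {v} eq with v Fin.≟ w
  ... | yes refl = subst (λ c → C c ≡ true) (just-injective eq) c₀∈C
  ... | no _     = range eq
  sizes′ : ∀ c → C c ≡ true → size F′ c ≡ s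
  sizes′ c Cc with c Fin.≟ c₀
  ... | yes refl = trans (size-≔-just F c w-blank) size₀
  ... | no c≢c₀  = trans (size-≔-other F c (λ p → just≢nothing p w-blank) (c≢c₀ ∘ sym ∘ just-injective))
                     (sizes c Cc c≢c₀)

exchange-colouring : Colouring n K → Fin n → Fin K → Fin n → Colouring n K
exchange-colouring F w X t = (F [ t ≔ nothing ]) [ w ≔ just X ]

-- Since `t` leaves `X` as `w` enters, `w` may be adjacent to `t`. The hole stays in `c₀`, and `t`
-- becomes the vertex to be placed.
exchange : ∀ {s} {G : Graph n} {S C} {F : Colouring n K} {w c₀ X t} → Near s G S C F w c₀ →
           X ≢ c₀ → F t ≡ just X → (∀ u → u ≢ t → F u ≡ just X → edge G w u ≡ false) →
           Near s G S C (exchange-colouring F w X t) t c₀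
exchange {s = s} {G} {S} {C} {F} {w} {c₀} {X} {t} near X≢c₀ Ft free = record
  { w∈S = trans (sym (domain t t≢w)) (cong is-just Ft)
  ; w-blank = trans (≔-other F₁ t≢w) (≔-same F t)
  ; domain = domain′ ; range = λ {v} → range′ {v} ; proper = Proper-≔ {G = G} {F₁} proper₁ free₁
  ; c₀∈C = c₀∈C
  ; size₀ = trans (cong suc (size-other c₀ (X≢c₀ ∘ sym))) size₀
  ; sizes = sizes′ }
  where
  open Near near
  F₁ = F [ t ≔ nothing ]
  F′ = exchange-colouring F w X t
  t≢w : t ≢ w
  t≢w refl = just≢nothing Ft w-blank
  F₁⁻ : ∀ {u c} → F₁ u ≡ just c → u ≢ t × F u ≡ just c
  F₁⁻ {u} eq with u Fin.≟ t
  F₁⁻ () | yes _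
  F₁⁻ eq | no u≢t = u≢t , eq
  proper₁ : Proper G F₁
  proper₁ p q = proper (proj₂ (F₁⁻ p)) (proj₂ (F₁⁻ q))
  free₁ : Free G F₁ X w
  free₁ u p with u≢t , q ← F₁⁻ p = free u u≢t q
  domain′ : ∀ v → v ≢ t → is-just (F′ v) ≡ S v
  domain′ v v≢t with v Fin.≟ w
  ... | yes refl = sym w∈S
  ... | no v≢w   = trans (cong is-just (≔-other F v≢t)) (domain v v≢w)
  range′ : ∀ {v c} → F′ v ≡ just c → C c ≡ true
  range′ {v} eq with v Fin.≟ w
  ... | yes refl = subst (λ c → C c ≡ true) (just-injective eq) (range Ft)
  ... | no _     = range (proj₂ (F₁⁻ eq))
  F₁w : F₁ w ≡ nothing
  F₁w = trans (≔-other F (t≢w ∘ sym)) w-blank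
  size-other : ∀ c → c ≢ X → size F′ c ≡ size F c
  size-other c c≢X =
    trans (size-≔-other F₁ c (λ p → just≢nothing p F₁w) (c≢X ∘ sym ∘ just-injective))
      (size-≔-other F c (λ p → c≢X (colour-unique p Ft)) (λ ()))
  sizes′ : ∀ c → C c ≡ true → c ≢ c₀ → size F′ c ≡ s
  sizes′ c Cc c≢c₀ with c Fin.≟ X
  ... | no c≢X   = trans (size-other c c≢X) (sizes c Cc c≢c₀)
  ... | yes refl = trans (size-≔-just F₁ c F₁w) (trans (size-≔-nothing F c Ft) (sizes c Cc c≢c₀))

exchange-agree : ∀ {F : Colouring n K} {w X t} c → F w ≡ nothing → F t ≡ just X → c ≢ X →
                 Agree F (exchange-colouring F w X t) c
exchange-agree {F = F} {w} {X} {t} c Fw Ft c≢X v = to , from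
  where
  F′ = exchange-colouring F w X t
  to : F v ≡ just c → F′ v ≡ just c
  to eq = trans (≔-other (F [ t ≔ nothing ]) v≢w) (trans (≔-other F v≢t) eq)
    where
    v≢w : v ≢ w
    v≢w refl = just≢nothing eq Fw
    v≢t : v ≢ t
    v≢t refl = c≢X (colour-unique eq Ft)
  from : F′ v ≡ just c → F v ≡ just c
  from eq with v Fin.≟ w | v Fin.≟ t
  from eq | yes _ | _     = contradiction (just-injective (sym eq)) c≢X
  from () | no _  | yes _
  from eq | no _  | no _  = eq

-- Induction on the chain: `w` displaces the movable vertex of the class it enters, and that vertex
-- is free for a class further down. Only `X` changes, and `X ∉ L`, so the rest of the chain
-- survives.
insert-along : ∀ {s} {G : Graph n} {S C} {F : Colouring n K} {w c₀ X L} → Chain G F c₀ L →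
               Near s G S C F w c₀ → X ∈ L → Free G F X w → Equitable s G S C
insert-along start near (here refl) free = insert near free
insert-along (step ch _ _ _ _) near (there X∈L) free = insert-along ch near X∈L free
insert-along {G = G} {F = F} {w} {c₀} (step {X} {Y} {t} {L} ch X∉L Ft Y∈L freeY) near (here refl) free =
  insert-along (Chain-transport agree ch) (exchange near X≢c₀ Ft (λ u _ → free u)) Y∈L
    (λ u p → freeY u (proj₂ (agree Y Y∈L u) p))
  where
  agree : ∀ c → c ∈ L → Agree F (exchange-colouring F w X t) c
  agree c c∈L = exchange-agree c (Near.w-blank near) Ft (λ { refl → X∉L c∈L })
  X≢c₀ : X ≢ c₀
  X≢c₀ refl = X∉L (c₀∈chain ch)

-- Accessible and terminal classes

_∈?_ : (c : Fin K) (L : List (Fin K)) → Dec (c ∈ L)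
_∈?_ = DecMembership._∈?_ Fin._≟_

inside outside : List (Fin K) → Fin K → Bool
inside  L c = does (c ∈? L)
outside L c = not (inside L c)

inside-true : ∀ {c : Fin K} {L} → c ∈ L → inside L c ≡ true
inside-true = dec-true (_ ∈? _)

inside-false : ∀ {c : Fin K} {L} → c ∉ L → inside L c ≡ false
inside-false = dec-false (_ ∈? _)

outside-true : ∀ {c : Fin K} {L} → c ∉ L → outside L c ≡ true
outside-true = cong not ∘ inside-false

outside-false : ∀ {c : Fin K} {L} → c ∈ L → outside L c ≡ false
outside-false = cong not ∘ inside-true

outside-true⁻ : ∀ {c : Fin K} {L} → outside L c ≡ true → c ∉ L
outside-true⁻ eq c∈L = true≢false eq (outside-false c∈L)

outside-< : ∀ {L L′ : List (Fin K)} {x} → (∀ c → c ∈ L → c ∈ L′) → x ∈ L′ → x ∉ L →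
            count (outside L′) < count (outside L)
outside-< L⊆L′ x∈L′ x∉L =
  count-< (λ c out → outside-true (outside-true⁻ out ∘ L⊆L′ c)) (outside-false x∈L′) (outside-true x∉L)

-- With `Q` always true the chain becomes the set of all accessible classes; with `Q` restricting to
-- classes of a chain other than `W` it becomes those that reach `c₀` without passing through `W`.
record Closure (G : Graph n) (F : Colouring n K) (c₀ : Fin K) (Q : Fin K → Set) (L : List (Fin K)) : Set where
  field
    chain   : List (Fin K)
    isChain : Chain G F c₀ chain
    extends : ∀ c → c ∈ L → c ∈ chain
    within  : ∀ c → c ∈ chain → c ∈ L ⊎ Q c
    closed  : ∀ {X Y t} → Q X → X ∉ chain → F t ≡ just X → Y ∈ chain → ¬ Free G F Y t

close : ∀ {G : Graph n} {F : Colouring n K} {c₀ L} {Q : Fin K → Set} → (∀ c → Dec (Q c)) →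
        Chain G F c₀ L → Closure G F c₀ Q L
close {G = G} {F} {c₀} {Q = Q} Q? ch = go ch (<-wellFounded _)
  where
  go : ∀ {L} → Chain G F c₀ L → Acc _<_ (count (outside L)) → Closure G F c₀ Q L
  go {L} ch (acc rec)
    with Fin.any? (λ t → Fin.any? λ X → F t ≟ᶜ just X ×-dec ¬? (X ∈? L) ×-dec Q? X ×-dec
                         Fin.any? λ Y → Y ∈? L ×-dec Free? G F Y t)
  ... | no ¬ext = record
    { chain = L ; isChain = ch ; extends = λ _ c∈L → c∈L ; within = λ _ → inj₁
    ; closed = λ QX X∉L Ft Y∈L free → ¬ext (_ , _ , Ft , X∉L , QX , _ , Y∈L , free) }
  ... | yes (t , X , Ft , X∉L , QX , Y , Y∈L , free) = record
    { chain = chain ; isChain = isChain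
    ; extends = λ c c∈L → extends c (there c∈L)
    ; within = within′ ; closed = closed }
    where
    open Closure (go (step ch X∉L Ft Y∈L free) (rec (outside-< (λ _ → there) (here refl) X∉L)))
    within′ : ∀ c → c ∈ chain → c ∈ L ⊎ Q c
    within′ c c∈ with within c c∈
    ... | inj₁ (here refl)  = inj₂ QX
    ... | inj₁ (there c∈L)  = inj₁ c∈L
    ... | inj₂ Qc           = inj₂ Qc

chain-exit : ∀ {G : Graph n} {F : Colouring n K} {c₀ L W} → Chain G F c₀ L → W ∈ L → W ≢ c₀ →
             ∃₂ λ t Y → F t ≡ just W × Y ∈ L × Y ≢ W × Free G F Y t
chain-exit start (here refl) W≢c₀ = contradiction refl W≢c₀
chain-exit (step ch X∉L Ft Y∈L free) (here refl) _ = _ , _ , Ft , there Y∈L , (λ { refl → X∉L Y∈L }) , free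
chain-exit (step ch _ _ _ _) (there W∈L) W≢c₀
  with t , Y , Ft , Y∈L , Y≢W , free ← chain-exit ch W∈L W≢c₀ = t , Y , Ft , there Y∈L , Y≢W , free

-- On the way from `c`, outside `P`, down to `c₀`, inside `P`, some move must cross into `P`.
chain-enter : ∀ {G : Graph n} {F : Colouring n K} {c₀ L P c} → Chain G F c₀ L → c₀ ∈ P → c ∈ L → c ∉ P →
              ∃₂ λ X t → X ∈ L × X ∉ P × F t ≡ just X × ∃ λ Y → Y ∈ P × Free G F Y t
chain-enter start c₀∈P (here refl) c∉P = contradiction c₀∈P c∉P
chain-enter (step ch _ _ _ _) c₀∈P (there c∈L) c∉P
  with X , t , X∈L , rest ← chain-enter ch c₀∈P c∈L c∉P = X , t , there X∈L , rest
chain-enter {P = P} (step {X} {Y} {t} ch _ Ft Y∈L free) c₀∈P (here refl) c∉P with Y ∈? P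
... | yes Y∈P = X , t , here refl , c∉P , Ft , Y , Y∈P , free
... | no  Y∉P with Z , u , Z∈L , rest ← chain-enter ch c₀∈P Y∈L Y∉P = Z , u , there Z∈L , rest

-- The other classes of `L` reach `c₀` without `W`, so they stay accessible however `W` is changed.
record Terminal (G : Graph n) (F : Colouring n K) (c₀ : Fin K) (L : List (Fin K)) (W : Fin K) : Set where
  field
    chain   : List (Fin K)
    isChain : Chain G F c₀ chain
    covers  : ∀ c → c ∈ L → c ≢ W → c ∈ chain
    within  : ∀ c → c ∈ chain → c ∈ L × c ≢ W

-- All classes of L outside P are terminal, and among the classes in P their vertices
-- can be moved to U only.
record Split (G : Graph n) (F : Colouring n K) (c₀ : Fin K) (L : List (Fin K)) : Set where
  field
    P        : List (Fin K)
    U        : Fin K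
    U∈P      : U ∈ P
    c₀∈P     : c₀ ∈ P
    P⊆L      : ∀ c → c ∈ P → c ∈ L
    proper   : ∃ λ c → c ∈ L × c ∉ P
    blocked  : ∀ {W Y x} → W ∈ L → W ∉ P → F x ≡ just W → Y ∈ P → Y ≢ U → ¬ Free G F Y x
    terminal : ∀ W → W ∈ L → W ∉ P → Terminal G F c₀ L W

-- If some W outside P is not terminal, take for P the classes that reach c₀ avoiding
-- W, together with U = W; this enlarges P.
split : ∀ {G : Graph n} {F : Colouring n K} {c₀ L c} → Chain G F c₀ L → c ∈ L → c ≢ c₀ → Split G F c₀ L
split {n} {K} {G} {F} {c₀} {L} chL c∈L c≢c₀ =
  -- Initially `P` consists of `c₀` and `U` is `c₀`, so the condition on classes of `P` other than
  -- `U` is vacuous.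
  go start (here refl) (λ { _ (here refl) → c₀∈chain chL }) (_ , c∈L , λ { (here refl) → c≢c₀ refl })
    (λ { _ _ _ (here refl) Y≢Y → contradiction refl Y≢Y }) (<-wellFounded _)
  where
  avoid : ∀ {P} → Chain G F c₀ P → ∀ W → Closure G F c₀ (λ c → c ∈ L × c ≢ W) P
  avoid chP W = close (λ c → c ∈? L ×-dec ¬? (c Fin.≟ W)) chP

  go : ∀ {P U} → Chain G F c₀ P → U ∈ P → (∀ c → c ∈ P → c ∈ L) → (∃ λ c → c ∈ L × c ∉ P) →
       (∀ {W Y x} → W ∈ L → W ∉ P → F x ≡ just W → Y ∈ P → Y ≢ U → ¬ Free G F Y x) →
       Acc _<_ (count (outside P)) → Split G F c₀ L
  go {P} {U} chP U∈P P⊆L proper blocked (acc rec)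
    with Fin.any? (λ W → W ∈? L ×-dec ¬? (W ∈? P) ×-dec
                         Fin.any? λ c → c ∈? L ×-dec ¬? (c Fin.≟ W) ×-dec ¬? (c ∈? Closure.chain (avoid chP W)))
  ... | no all-covered = record
    { P = P ; U = U ; U∈P = U∈P ; c₀∈P = c₀∈chain chP ; P⊆L = P⊆L ; proper = proper
    ; blocked = blocked ; terminal = terminal }
    where
    terminal : ∀ W → W ∈ L → W ∉ P → Terminal G F c₀ L W
    terminal W W∈L W∉P = record
      { chain = chain ; isChain = isChain ; covers = covers ; within = within′ }
      where
      open Closure (avoid chP W)
      covers : ∀ c → c ∈ L → c ≢ W → c ∈ chain
      covers c c∈L c≢W with c ∈? chain
      ... | yes c∈ = c∈
      ... | no c∉  = contradiction (W , W∈L , W∉P , c , c∈L , c≢W , c∉) all-covered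
      within′ : ∀ c → c ∈ chain → c ∈ L × c ≢ W
      within′ c c∈ with within c c∈
      ... | inj₁ c∈P = P⊆L c c∈P , λ { refl → W∉P c∈P }
      ... | inj₂ q   = q
  ... | yes (W , W∈L , W∉P , c , c∈L , c≢W , c∉)
    with X , t , X∈L , X∉ , Ft , Y , Y∈ , free ← chain-enter chL (c₀∈chain (Closure.isChain (avoid chP W))) c∈L c∉
    with X Fin.≟ W
  -- Only `W` itself can still enter the closure: any other class of `L` with a vertex free for it
  -- would already have been added.
  ...   | no X≢W = contradiction free (Closure.closed (avoid chP W) (X∈L , X≢W) X∉ Ft Y∈)
  ...   | yes refl = go (step isChain X∉ Ft Y∈ free) (here refl) ⊆L
      (c , c∈L , λ { (here p) → c≢W p ; (there p) → c∉ p })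
      (λ { V∈L V∉ Fx (here refl) Y≢Y → contradiction refl Y≢Y
         ; V∈L V∉ Fx (there Y∈) _ → closed (V∈L , V∉ ∘ here) (V∉ ∘ there) Fx Y∈ })
      (rec (outside-< (λ d → there ∘ extends d) (here refl) W∉P))
    where
    open Closure (avoid chP W)
    ⊆L : ∀ d → d ∈ (W ∷ chain) → d ∈ L
    ⊆L d (here refl) = W∈L
    ⊆L d (there d∈) with within d d∈
    ... | inj₁ d∈P = P⊆L d d∈P
    ... | inj₂ q   = proj₁ q

-- Vertex deletion, the induction statement, greedy independent sets

_∖_ : (Fin n → Bool) → Fin n → Fin n → Bool
(S ∖ v) u = S u ∧ not (does (u Fin.≟ v))

∧-true : ∀ {a b} → a ∧ b ≡ true → a ≡ true × b ≡ true
∧-true {true} {true} _ = refl , refl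

∖-true⁻ : ∀ (S : Fin n → Bool) v {u} → (S ∖ v) u ≡ true → S u ≡ true × u ≢ v
∖-true⁻ S v {u} eq with u Fin.≟ v | ∧-true {S u} eq
... | no u≢v | Su , _ = Su , u≢v

∖-other : ∀ (S : Fin n → Bool) v {u} → u ≢ v → (S ∖ v) u ≡ S u
∖-other S v {u} u≢v rewrite dec-false (u Fin.≟ v) u≢v = ∧-identityʳ (S u)

∖-same : ∀ (S : Fin n → Bool) v → (S ∖ v) v ≡ false
∖-same S v rewrite dec-true (v Fin.≟ v) refl = ∧-zeroʳ (S v)

count-∖ : ∀ (S : Fin n → Bool) v → S v ≡ true → count S ≡ suc (count (S ∖ v))
count-∖ S v Sv = begin
  count S                          ≡⟨ +-identityʳ _ ⟨
  count S + 0                      ≡⟨ cong (λ b → count S + 𝟙 b) (∖-same S v) ⟨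
  count S + 𝟙 ((S ∖ v) v)          ≡⟨ sum-differ _ _ v (λ u u≢v → cong 𝟙 (sym (∖-other S v u≢v))) ⟩
  count (S ∖ v) + 𝟙 (S v)          ≡⟨ cong (λ b → count (S ∖ v) + 𝟙 b) Sv ⟩
  count (S ∖ v) + 1                ≡⟨ +-comm _ 1 ⟩
  suc (count (S ∖ v))              ∎
  where open ≡-Reasoning

deg-mono : ∀ (G : Graph n) {S T : Fin n → Bool} → (∀ u → S u ≡ true → T u ≡ true) →
           ∀ v → deg G S v ≤ deg G T v
deg-mono G {S} {T} S⊆T v = sum-mono-≤ λ u → *-monoˡ-≤ (𝟙 (edge G v u)) (le u)
  where
  le : ∀ u → 𝟙 (S u) ≤ 𝟙 (T u)
  le u with S u in eq
  ... | false = z≤n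
  ... | true  = ≤-reflexive (cong 𝟙 (sym (S⊆T u eq)))

Agree-size : ∀ {F F′ : Colouring n K} {c} → Agree F F′ c → size F c ≡ size F′ c
Agree-size {F = F} {F′} {c} agree = sum-cong-≗ λ v → cong 𝟙 (same v)
  where
  same : ∀ v → class F c v ≡ class F′ c v
  same v with F v ≟ᶜ just c
  ... | yes p = sym (class-true F′ (proj₁ (agree v) p))
  ... | no ¬p = sym (class-false F′ (¬p ∘ proj₂ (agree v)))

-- Vertices and colours are subsets `S` and `C` of fixed types, so that the induction can recolour a
-- part of the graph with the leftover colours without renaming anything.
EquitableColourings : (n K s N : ℕ) → Set
EquitableColourings n K s N =
  ∀ (G : Graph n) (S : Fin n → Bool) (C : Fin K → Bool) → count C ≡ N → count S ≡ N * s →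
  (∀ v → S v ≡ true → deg G S v < N) → Equitable s G S C

𝟙-∧ : ∀ a b → 𝟙 (a ∧ b) ≡ 𝟙 a * 𝟙 b
𝟙-∧ true  b = sym (+-identityʳ (𝟙 b))
𝟙-∧ false b = refl

∧-intro : ∀ {a b} → a ≡ true → b ≡ true → a ∧ b ≡ true
∧-intro refl refl = refl

𝟙-≥1 : ∀ {b} → 1 ≤ 𝟙 b → b ≡ true
𝟙-≥1 {true} _ = refl

count-≥1 : ∀ (P : Fin n → Bool) → 1 ≤ count P → ∃ λ i → P i ≡ true
count-≥1 {n} P pos with i , lt ← sum<⇒∃< (𝟙 ∘ P) (const 0)
                               (subst (_< count P) (sym (sum-zero {n} {const 0} (λ _ → refl))) pos) = i , 𝟙-≥1 lt

count-≥2 : ∀ (P : Fin n → Bool) → 2 ≤ count P → ∃₂ λ i j → i ≢ j × P i ≡ true × P j ≡ true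
count-≥2 P two with i , Pi ← count-≥1 P (≤-trans (s≤s z≤n) two)
  with j , Pj ← count-≥1 (P ∖ i) (s≤s⁻¹ (≤-trans two (≤-reflexive (count-∖ P i Pi))))
  with Pj , j≢i ← ∖-true⁻ P i Pj = i , j , j≢i ∘ sym , Pi , Pj

-- For the weight one plus degree, `large` expresses that the closed neighbourhoods of the members
-- of `I` cover `R`.
record IndependentSubset (G : Graph n) (R : Fin n → Bool) (weight : Fin n → ℕ) : Set where
  field
    I           : Fin n → Bool
    subset      : ∀ v → I v ≡ true → R v ≡ true
    independent : ∀ u v → u ≢ v → I u ≡ true → I v ≡ true → edge G u v ≡ false
    large       : count R ≤ Σ⟨ I ⟩ weight

-- Greedily: a chosen vertex x rules out itself and its neighbours.
independent-subset : ∀ (G : Graph n) (B : Fin n → Bool) → IndependentSubset G B (suc ∘ deg G B)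
independent-subset {n} G B = go B (λ _ Bv → Bv) (<-wellFounded _)
  where
  go : ∀ R → (∀ v → R v ≡ true → B v ≡ true) → Acc _<_ (count R) → IndependentSubset G R (suc ∘ deg G B)
  go R R⊆B (acc rec) with Fin.any? (λ v → R v ≟ᵇ true)
  ... | no empty = record
    { I = const false ; subset = λ _ () ; independent = λ _ _ _ () ; large = ≤-reflexive
        (trans (sum-zero λ v → cong 𝟙 (¬-not (empty ∘ (v ,_)))) (sym (sum-zero {n} {const 0} λ _ → refl))) }
  ... | yes (x , Rx) = record { I = I ; subset = subset ; independent = independent ; large = large }
    where
    R′ : Fin n → Bool
    R′ v = (R ∖ x) v ∧ not (edge G x v)
    R′⊆R : ∀ v → R′ v ≡ true → R v ≡ true
    R′⊆R v = proj₁ ∘ ∧-true ∘ proj₁ ∘ ∧-true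
    R′x : R′ x ≡ false
    R′x rewrite ∖-same R x = refl
    open IndependentSubset (go R′ (λ v → R⊆B v ∘ R′⊆R v) (rec (count-< R′⊆R R′x Rx)))
      renaming (I to I′; subset to subset′; independent to independent′; large to large′)
    I : Fin n → Bool
    I v = does (v Fin.≟ x) ∨ I′ v
    subset : ∀ v → I v ≡ true → R v ≡ true
    subset v Iv with v Fin.≟ x
    ... | yes refl = Rx
    ... | no _     = R′⊆R v (subset′ v Iv)
    apart : ∀ v → I′ v ≡ true → edge G x v ≡ false
    apart v I′v with edge G x v | proj₂ (∧-true {(R ∖ x) v} (subset′ v I′v))
    ... | false | _ = refl
    independent : ∀ u v → u ≢ v → I u ≡ true → I v ≡ true → edge G u v ≡ false
    independent u v u≢v Iu Iv with u Fin.≟ x | v Fin.≟ x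
    ... | yes refl | yes refl = contradiction refl u≢v
    ... | yes refl | no _     = apart v Iv
    ... | no _     | yes refl = trans (symm G u v) (apart u Iu)
    ... | no _     | no _     = independent′ u v u≢v Iu Iv
    φ = suc ∘ deg G B
    I′x : I′ x ≡ false
    I′x = ¬-not λ I′x → true≢false (subset′ x I′x) R′x
    -- A vertex of `R` survives in `R′`, or is `x`, or is a neighbour of `x` in `B`; the last two
    -- kinds are paid for by the weight of `x`.
    pointwise : ∀ v → 𝟙 (R v) ≤ 𝟙 (R′ v) + (𝟙 (does (v Fin.≟ x)) + 𝟙 (B v) * 𝟙 (edge G x v))
    pointwise v with R v in Rv | v Fin.≟ x | edge G x v
    ... | false | _     | _     = z≤n
    ... | true  | no _  | false = s≤s z≤n
    ... | true  | yes _ | _     = s≤s z≤n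
    ... | true  | no _  | true rewrite R⊆B v Rv = ≤-refl
    split-sum : ∀ v → 𝟙 (I′ v) * φ v + 𝟙 (does (v Fin.≟ x)) * φ v ≡ 𝟙 (I v) * φ v
    split-sum v with v Fin.≟ x
    ... | no _ = +-identityʳ _
    ... | yes refl rewrite I′x = refl
    large : count R ≤ Σ⟨ I ⟩ φ
    large = begin
      count R
        ≤⟨ sum-mono-≤ pointwise ⟩
      sum (λ v → 𝟙 (R′ v) + (𝟙 (does (v Fin.≟ x)) + 𝟙 (B v) * 𝟙 (edge G x v)))
        ≡⟨ sum-+ (𝟙 ∘ R′) _ ⟩
      count R′ + sum (λ v → 𝟙 (does (v Fin.≟ x)) + 𝟙 (B v) * 𝟙 (edge G x v))
        ≡⟨ cong (count R′ +_) (sum-+ (λ v → 𝟙 (does (v Fin.≟ x))) _) ⟩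
      count R′ + (sum (λ v → 𝟙 (does (v Fin.≟ x))) + deg G B x)
        ≡⟨ cong (λ k → count R′ + (k + deg G B x)) (count-at x) ⟩
      count R′ + φ x
        ≤⟨ +-monoˡ-≤ (φ x) large′ ⟩
      Σ⟨ I′ ⟩ φ + φ x
        ≡⟨ cong (Σ⟨ I′ ⟩ φ +_) (sum-at φ x) ⟨
      Σ⟨ I′ ⟩ φ + sum (λ v → 𝟙 (does (v Fin.≟ x)) * φ v)
        ≡⟨ sum-+ (λ v → 𝟙 (I′ v) * φ v) _ ⟨
      sum (λ v → 𝟙 (I′ v) * φ v + 𝟙 (does (v Fin.≟ x)) * φ v)
        ≡⟨ sum-cong-≗ split-sum ⟩
      Σ⟨ I ⟩ φ ∎
      where open ≤-Reasoning

-- Counting when every accessible class blocks the uncoloured vertex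

module Blocked
  {n K s N : ℕ} {G : Graph n} {S : Fin n → Bool} {C : Fin K → Bool}
  {F : Colouring n K} {w : Fin n} {c₀ : Fin K} {L : List (Fin K)}
  (near : Near s G S C F w c₀) (chL : Chain G F c₀ L)
  (closed : ∀ {X Y t} → X ∉ L → F t ≡ just X → Y ∈ L → ¬ Free G F Y t)
  (w-blocked : ∀ {Y} → Y ∈ L → ¬ Free G F Y w)
  (deg<N : ∀ v → S v ≡ true → deg G S v < N) (countC : count C ≡ N)
  (colourings : ∀ {N′} → N′ < N → EquitableColourings n K s N′)
  where

  open Near near

  rest : Fin K → Bool
  rest c = C c ∧ outside L c

  -- The default `true` catches `w`, the only uncoloured vertex of `S`.
  B : Fin n → Bool
  B v = S v ∧ maybe′ (outside L) true (F v)

  a b : ℕ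
  a = count (inside L)
  b = count rest

  L⊆C : ∀ {c} → c ∈ L → C c ≡ true
  L⊆C {c} c∈L with c Fin.≟ c₀
  ... | yes refl = c₀∈C
  ... | no c≢c₀ with t , _ , Ft , _ ← chain-exit chL c∈L c≢c₀ = range Ft

  a+b≡N : a + b ≡ N
  a+b≡N = trans (trans (sym (sum-+ (𝟙 ∘ inside L) (𝟙 ∘ rest))) (sum-cong-≗ pointwise)) countC
    where
    pointwise : ∀ c → 𝟙 (inside L c) + 𝟙 (rest c) ≡ 𝟙 (C c)
    pointwise c with c ∈? L
    ... | no _ = cong 𝟙 (∧-identityʳ (C c))
    ... | yes c∈L rewrite L⊆C c∈L = refl

  a≥1 : 1 ≤ a
  a≥1 = ≤-trans (≤-reflexive (cong 𝟙 (sym (inside-true (c₀∈chain chL))))) (term≤sum (𝟙 ∘ inside L) c₀)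

  b<N : b < N
  b<N = ≤-trans (+-monoˡ-≤ b a≥1) (≤-reflexive a+b≡N)

  coloured⇒S : ∀ {v c} → F v ≡ just c → S v ≡ true
  coloured⇒S {v} Fv = trans (sym (domain v λ { refl → just≢nothing Fv w-blank })) (cong is-just Fv)

  B-coloured : ∀ {v c} → F v ≡ just c → B v ≡ outside L c
  B-coloured Fv rewrite coloured⇒S Fv | Fv = refl

  B-w : B w ≡ true
  B-w rewrite w∈S | w-blank = refl

  B⊆S : ∀ v → B v ≡ true → S v ≡ true
  B⊆S v = proj₁ ∘ ∧-true

  B-cases : ∀ {v} → B v ≡ true → v ≡ w ⊎ ∃ λ c → F v ≡ just c × c ∉ L
  B-cases {v} Bv with v Fin.≟ w
  ... | yes v≡w = inj₁ v≡w
  ... | no v≢w with F v in eq | domain v v≢w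
  ...   | just c  | _  = inj₂ (c , refl , outside-true⁻ (trans (sym (B-coloured eq)) (trans (sym reB) Bv)))
    where
    reB : S v ∧ maybe′ (outside L) true (just c) ≡ B v
    reB = cong (λ x → S v ∧ maybe′ (outside L) true x) (sym eq)
  ...   | nothing | p with () ← trans p (proj₁ (∧-true {S v} Bv))

  deg-split : ∀ v → sum (λ c → 𝟙 (inside L c) * classDeg G F c v) + deg G B v ≡ deg G S v
  deg-split v = begin
    sum (λ c → 𝟙 (inside L c) * classDeg G F c v) + deg G B v
      ≡⟨ cong (_+ deg G B v) (∑-classes F (𝟙 ∘ inside L) (𝟙 ∘ edge G v)) ⟩
    sum (λ u → maybe′ (𝟙 ∘ inside L) 0 (F u) * 𝟙 (edge G v u)) + deg G B v
      ≡⟨ sum-+ (λ u → maybe′ (𝟙 ∘ inside L) 0 (F u) * 𝟙 (edge G v u)) (λ u → 𝟙 (B u) * 𝟙 (edge G v u)) ⟨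
    sum (λ u → maybe′ (𝟙 ∘ inside L) 0 (F u) * 𝟙 (edge G v u) + 𝟙 (B u) * 𝟙 (edge G v u))
      ≡⟨ sum-cong-≗ (λ u → sym (*-distribʳ-+ (𝟙 (edge G v u)) (maybe′ (𝟙 ∘ inside L) 0 (F u)) (𝟙 (B u)))) ⟩
    sum (λ u → (maybe′ (𝟙 ∘ inside L) 0 (F u) + 𝟙 (B u)) * 𝟙 (edge G v u))
      ≡⟨ sum-cong-≗ (λ u → cong (_* 𝟙 (edge G v u)) (pointwise u)) ⟩
    deg G S v ∎
    where
    open ≡-Reasoning
    pointwise : ∀ u → maybe′ (𝟙 ∘ inside L) 0 (F u) + 𝟙 (B u) ≡ 𝟙 (S u)
    pointwise u with F u in eq
    ... | nothing = cong 𝟙 (∧-identityʳ (S u))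
    ... | just c rewrite coloured⇒S eq with c ∈? L
    ...   | yes _ = refl
    ...   | no _  = refl

  -- The deficient class `c₀` lies in `L`, so the `b` classes outside are full, and `w` comes on
  -- top. This surplus of one makes the later counts strict.
  count-B : count B ≡ suc (b * s)
  count-B = begin
    count B
      ≡⟨ sum-cong-≗ pointwise ⟩
    sum (λ u → 𝟙 (does (u Fin.≟ w)) + maybe′ (𝟙 ∘ rest) 0 (F u) * 1)
      ≡⟨ sum-+ (λ u → 𝟙 (does (u Fin.≟ w))) _ ⟩
    sum (λ u → 𝟙 (does (u Fin.≟ w))) + sum (λ u → maybe′ (𝟙 ∘ rest) 0 (F u) * 1)
      ≡⟨ cong₂ _+_ (count-at w) (sym (∑-classes F (𝟙 ∘ rest) (const 1))) ⟩
    1 + sum (λ c → 𝟙 (rest c) * Σ⟨ class F c ⟩ (const 1))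
      ≡⟨ cong suc (sum-cong-≗ class-size) ⟩
    1 + sum (λ c → 𝟙 (rest c) * s)
      ≡⟨ cong suc (*-distribʳ-sum s (𝟙 ∘ rest)) ⟨
    suc (b * s) ∎
    where
    open ≡-Reasoning
    class-size : ∀ c → 𝟙 (rest c) * Σ⟨ class F c ⟩ (const 1) ≡ 𝟙 (rest c) * s
    class-size c with rest c in eq
    ... | false = refl
    ... | true with Cc , out ← ∧-true {C c} eq = cong (_+ 0)
      (trans (sum-cong-≗ (λ v → *-identityʳ (𝟙 (class F c v))))
        (sizes c Cc λ { refl → outside-true⁻ out (c₀∈chain chL) }))
    pointwise : ∀ u → 𝟙 (B u) ≡ 𝟙 (does (u Fin.≟ w)) + maybe′ (𝟙 ∘ rest) 0 (F u) * 1
    pointwise u with u Fin.≟ w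
    ... | yes refl rewrite B-w | w-blank = refl
    ... | no u≢w with F u in eq
    ...   | nothing rewrite trans (sym (domain u u≢w)) (cong is-just eq) = refl
    ...   | just c rewrite coloured⇒S eq | range eq = sym (*-identityʳ _)

  blocked : ∀ {y c} → B y ≡ true → c ∈ L → 1 ≤ classDeg G F c y
  blocked By c∈L with B-cases By
  ... | inj₁ refl            = ¬Free⇒deg≥1 G F (w-blocked c∈L)
  ... | inj₂ (d , Fy , d∉L) = ¬Free⇒deg≥1 G F (closed d∉L Fy c∈L)

  -- Neighbours spent on the classes of `L` are missing from `B`, as there are fewer than `a + b` in
  -- total; `f` is any lower bound for what each class takes.
  degB-bound : ∀ {v} (f : Fin K → ℕ) → S v ≡ true → (∀ c → c ∈ L → f c ≤ classDeg G F c v) →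
               sum (λ c → 𝟙 (inside L c) * f c) + deg G B v < a + b
  degB-bound {v} f Sv f≤ = begin-strict
    sum (λ c → 𝟙 (inside L c) * f c) + deg G B v
      ≤⟨ +-monoˡ-≤ (deg G B v) (sum-mono-≤ le) ⟩
    sum (λ c → 𝟙 (inside L c) * classDeg G F c v) + deg G B v
      ≡⟨ deg-split v ⟩
    deg G S v
      <⟨ deg<N v Sv ⟩
    N
      ≡⟨ a+b≡N ⟨
    a + b ∎
    where
    open ≤-Reasoning
    le : ∀ c → 𝟙 (inside L c) * f c ≤ 𝟙 (inside L c) * classDeg G F c v
    le c with c ∈? L
    ... | yes c∈L = *-monoʳ-≤ 1 (f≤ c c∈L)
    ... | no _    = z≤n

  -- Each of the `a` classes of `L` takes at least one neighbour of `y`.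
  degB<b : ∀ {y} → B y ≡ true → deg G B y < b
  degB<b {y} By = +-cancelˡ-< a _ _ (subst (λ x → x + deg G B y < a + b) (sum-cong-≗ (λ c → *-identityʳ (𝟙 (inside L c))))
    (degB-bound (const 1) (B⊆S y By) (λ c c∈L → blocked By c∈L)))

  -- Without `y`, the set `B` has exactly `b * s` vertices, and `b < N` because `L` contains `c₀`;
  -- so the induction hypothesis for `b` colours applies.
  recolouring : ∀ {y} → B y ≡ true → Equitable s G (B ∖ y) rest
  recolouring {y} By = colourings b<N G (B ∖ y) rest refl
    (suc-injective (trans (sym (count-∖ B y By)) count-B))
    (λ v v∈ → ≤-<-trans (deg-mono G (λ u → proj₁ ∘ ∖-true⁻ B y) v) (degB<b (proj₁ (∖-true⁻ B y v∈))))

  -- The colouring after B − y is recoloured, y moves into the class W in place of its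
  -- only neighbour z there, and z loses its colour.
  record Swap (y z : Fin n) (W : Fin K) : Set where
    field
      colour : Colouring n K
      isNear : Near s G S C colour z c₀
      agree  : ∀ c → c ∈ L → c ≢ W → Agree F colour c
      keeps  : ∀ {v} → v ≢ z → F v ≡ just W → colour v ≡ just W
      gains  : ∀ {v} → colour v ≡ just W → v ≡ y ⊎ (v ≢ z × F v ≡ just W)
      outer  : ∀ {v} → B v ≡ true → v ≢ y → ∃ λ c → c ∉ L × colour v ≡ just c

  swap : ∀ {y z W} → B y ≡ true → W ∈ L → W ≢ c₀ → F z ≡ just W → edge G y z ≡ true →
         classDeg G F W y ≡ 1 → Swap y z W
  swap {y} {z} {W} By W∈L W≢c₀ Fz yz d≡1 = record
    { colour = F₂
    ; isNear = exchange near₁ W≢c₀ F₁z λ u u≢z F₁u →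
        deg≡1⇒unique G (class F W) d≡1 (class-true F Fz)
          (class-true F (proj₂ (agree₁ W W∈L u) F₁u)) yz (u≢z ∘ sym)
    ; agree = agree₂ ; keeps = keeps ; gains = gains ; outer = outer }
    where
    open Equitable (recolouring By)
      renaming (colour to g; domain to g-domain; range to g-range; proper to g-proper; sizes to g-sizes)

    -- On `B` the colours of `g` lie outside `L`; off `B` those of `F` lie in `L`. Hence the two
    -- parts cannot conflict.
    F₁ F₂ : Colouring n K
    F₁ v = if B v then g v else F v
    F₂ = exchange-colouring F₁ y W z

    F₁-B : ∀ {v} → B v ≡ true → F₁ v ≡ g v
    F₁-B Bv rewrite Bv = refl

    g⇒B : ∀ {v c} → g v ≡ just c → B v ≡ true × v ≢ y
    g⇒B {v} gv = ∖-true⁻ B y (trans (sym (g-domain v)) (cong is-just gv))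

    g⇒∉L : ∀ {v c} → g v ≡ just c → c ∉ L
    g⇒∉L {c = c} gv = outside-true⁻ (proj₂ (∧-true {C c} (g-range gv)))

    F₁-L : ∀ {v c} → c ∈ L → F v ≡ just c → F₁ v ≡ just c
    F₁-L c∈L Fv rewrite trans (B-coloured Fv) (outside-false c∈L) = Fv

    F₁-cases : ∀ {v c} → F₁ v ≡ just c → (c ∉ L × g v ≡ just c) ⊎ (c ∈ L × F v ≡ just c)
    F₁-cases {v} {c} F₁v with B v in Bv
    ... | true  = inj₁ (g⇒∉L F₁v , F₁v)
    ... | false with c ∈? L
    ...   | yes c∈L = inj₂ (c∈L , F₁v)
    ...   | no c∉L  = contradiction Bv (true≢false (trans (B-coloured F₁v) (outside-true c∉L)))

    agree₁ : ∀ c → c ∈ L → Agree F F₁ c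
    agree₁ c c∈L v = F₁-L c∈L , from
      where
      from : F₁ v ≡ just c → F v ≡ just c
      from F₁v with F₁-cases F₁v
      ... | inj₁ (c∉L , _)  = contradiction c∈L c∉L
      ... | inj₂ (_ , Fv)   = Fv

    F₁z : F₁ z ≡ just W
    F₁z = F₁-L W∈L Fz

    F₁y : F₁ y ≡ nothing
    F₁y = trans (F₁-B By) (is-just-false (trans (g-domain y) (∖-same B y)))

    near₁ : Near s G S C F₁ y c₀
    near₁ = record
      { w∈S = B⊆S y By ; w-blank = F₁y ; domain = domain₁ ; range = λ {v} → range₁ {v}
      ; proper = λ {u} {v} → proper₁ {u} {v}
      ; c₀∈C = c₀∈C
      ; size₀ = trans (cong suc (sym (Agree-size (agree₁ c₀ (c₀∈chain chL))))) size₀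
      ; sizes = sizes₁ }
      where
      domain₁ : ∀ v → v ≢ y → is-just (F₁ v) ≡ S v
      domain₁ v v≢y with B v in Bv
      ... | true  = trans (g-domain v) (trans (∖-other B y v≢y) (trans Bv (sym (B⊆S v Bv))))
      ... | false = domain v λ { refl → true≢false B-w Bv }
      range₁ : ∀ {v c} → F₁ v ≡ just c → C c ≡ true
      range₁ F₁v with F₁-cases F₁v
      ... | inj₁ (_ , gv) = proj₁ (∧-true (g-range gv))
      ... | inj₂ (_ , Fv) = range Fv
      proper₁ : Proper G F₁
      proper₁ F₁u F₁v with F₁-cases F₁u | F₁-cases F₁v
      ... | inj₁ (_ , gu)   | inj₁ (_ , gv)   = g-proper gu gv
      ... | inj₁ (c∉L , _)  | inj₂ (c∈L , _)  = contradiction c∈L c∉L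
      ... | inj₂ (c∈L , _)  | inj₁ (c∉L , _)  = contradiction c∈L c∉L
      ... | inj₂ (_ , Fu)   | inj₂ (_ , Fv)   = proper Fu Fv
      sizes₁ : ∀ c → C c ≡ true → c ≢ c₀ → size F₁ c ≡ s
      sizes₁ c Cc c≢c₀ with c ∈? L
      ... | yes c∈L = trans (sym (Agree-size (agree₁ c c∈L))) (sizes c Cc c≢c₀)
      ... | no c∉L  = trans (Agree-size agree-g) (g-sizes c (cong₂ _∧_ Cc (outside-true c∉L)))
        where
        agree-g : Agree F₁ g c
        agree-g v = to , λ gv → trans (F₁-B (proj₁ (g⇒B gv))) gv
          where
          to : F₁ v ≡ just c → g v ≡ just c
          to F₁v with F₁-cases F₁v
          ... | inj₁ (_ , gv)   = gv
          ... | inj₂ (c∈L , _)  = contradiction c∈L c∉L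

    agree₂ : ∀ c → c ∈ L → c ≢ W → Agree F F₂ c
    agree₂ c c∈L c≢W v =
      (λ Fv → proj₁ (exchange-agree c F₁y F₁z c≢W v) (F₁-L c∈L Fv)) ,
      (λ F₂v → proj₂ (agree₁ c c∈L v) (proj₂ (exchange-agree c F₁y F₁z c≢W v) F₂v))

    keeps : ∀ {v} → v ≢ z → F v ≡ just W → F₂ v ≡ just W
    keeps {v} v≢z Fv with v Fin.≟ y
    ... | yes _ = refl
    ... | no _  = trans (≔-other F₁ v≢z) (F₁-L W∈L Fv)

    gains : ∀ {v} → F₂ v ≡ just W → v ≡ y ⊎ (v ≢ z × F v ≡ just W)
    gains {v} F₂v with v Fin.≟ y | v Fin.≟ z
    gains F₂v | yes v≡y | _      = inj₁ v≡y
    gains ()  | no _    | yes _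
    gains {v} F₂v | no _ | no v≢z = inj₂ (v≢z , proj₂ (agree₁ W W∈L v) F₂v)

    outer : ∀ {v} → B v ≡ true → v ≢ y → ∃ λ c → c ∉ L × F₂ v ≡ just c
    outer {v} Bv v≢y with c , gv ← is-just-true (trans (g-domain v) (trans (∖-other B y v≢y) Bv)) =
      c , g⇒∉L gv ,
      proj₁ (exchange-agree c F₁y F₁z (λ { refl → g⇒∉L gv W∈L }) v) (trans (F₁-B Bv) gv)

  size≤s : ∀ {W} → W ∈ L → size F W ≤ s
  size≤s {W} W∈L with W Fin.≟ c₀
  ... | yes refl = ≤-trans (n≤1+n _) (≤-reflexive size₀)
  ... | no W≢c₀  = ≤-reflexive (sizes W (L⊆C W∈L) W≢c₀)

  -- Heavy vertices count twice, so that every y in B receives at least 2 from its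
  -- neighbours in W, while no vertex of W gives more than 2b.
  overloaded : ∀ {W} → W ∈ L → (heavy : Fin n → Bool) →
               (∀ {x} → F x ≡ just W → heavy x ≡ true → deg G B x ≤ b) →
               (∀ {x} → F x ≡ just W → deg G B x ≤ 2 * b) →
               (∀ {x y} → B y ≡ true → F x ≡ just W → edge G y x ≡ true → classDeg G F W y ≡ 1 → heavy x ≡ true) → ⊥
  overloaded {W} W∈L heavy heavy≤ light≤ solo = <-irrefl refl (begin-strict
    b * s * 2                                       <⟨ n≤1+n _ ⟩
    suc (b * s) * 2                                 ≡⟨ cong (_* 2) count-B ⟨
    count B * 2                                     ≡⟨ *-distribʳ-sum 2 (𝟙 ∘ B) ⟩
    sum (λ y → 𝟙 (B y) * 2)                         ≤⟨ sum-mono-≤ receives ⟩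
    sum (λ y → sum (λ x → 𝟙 (B y) * flow y x))      ≡⟨ ∑-comm (λ y x → 𝟙 (B y) * flow y x) ⟩
    sum (λ x → sum (λ y → 𝟙 (B y) * flow y x))      ≤⟨ sum-mono-≤ gives ⟩
    sum (λ x → 𝟙 (class F W x) * (2 * b))           ≡⟨ *-distribʳ-sum (2 * b) (𝟙 ∘ class F W) ⟨
    size F W * (2 * b)                              ≤⟨ *-monoˡ-≤ (2 * b) (size≤s W∈L) ⟩
    s * (2 * b)                                     ≡⟨ rearrange s b ⟩
    b * s * 2                                       ∎)
    where
    open ≤-Reasoning
    rearrange : ∀ s b → s * (2 * b) ≡ b * s * 2
    rearrange = solve-∀
    κ : Fin n → ℕ
    κ x = 1 + 𝟙 (heavy x)
    flow : Fin n → Fin n → ℕ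
    flow y x = 𝟙 (class F W x) * (κ x * 𝟙 (edge G y x))
    total : ∀ y → B y ≡ true → 2 ≤ sum (flow y)
    total y By with classDeg G F W y in d | blocked By W∈L
    ... | suc (suc k) | _ = begin
      2                   ≤⟨ s≤s (s≤s z≤n) ⟩
      suc (suc k)         ≡⟨ d ⟨
      classDeg G F W y    ≤⟨ sum-mono-≤ (λ x → *-monoʳ-≤ (𝟙 (class F W x)) (m≤m+n _ _)) ⟩
      sum (flow y)        ∎
    -- The single neighbour of `y` in `W` is heavy by `solo`, so it alone supplies the 2.
    ... | 1 | _ with x , e ← count-≥1 (λ x → class F W x ∧ edge G y x)
                       (≤-reflexive (trans (sym d) (sum-cong-≗ λ x → sym (𝟙-∧ (class F W x) _))))
                with x∈W , yx ← ∧-true {class F W x} e = begin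
      2                   ≡⟨ flow≡2 ⟨
      flow y x            ≤⟨ term≤sum (flow y) x ⟩
      sum (flow y)        ∎
      where
      flow≡2 : flow y x ≡ 2
      flow≡2 rewrite solo By (class-true⁻ F x∈W) yx d | x∈W | yx = refl
    receives : ∀ y → 𝟙 (B y) * 2 ≤ sum (λ x → 𝟙 (B y) * flow y x)
    receives y with B y in By
    ... | false = z≤n
    ... | true  = ≤-trans (total y By) (≤-reflexive (sum-cong-≗ λ x → sym (*-identityˡ (flow y x))))
    regroup : ∀ β c k e → β * (c * (k * e)) ≡ c * k * (β * e)
    regroup = solve-∀
    gives : ∀ x → sum (λ y → 𝟙 (B y) * flow y x) ≤ 𝟙 (class F W x) * (2 * b)
    gives x = begin
      sum (λ y → 𝟙 (B y) * flow y x)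
        ≡⟨ sum-cong-≗ (λ y → trans (regroup (𝟙 (B y)) (𝟙 (class F W x)) (κ x) (𝟙 (edge G y x)))
             (cong (λ e → 𝟙 (class F W x) * κ x * (𝟙 (B y) * 𝟙 e)) (symm G y x))) ⟩
      sum (λ y → 𝟙 (class F W x) * κ x * (𝟙 (B y) * 𝟙 (edge G x y)))
        ≡⟨ *-distribˡ-sum (𝟙 (class F W x) * κ x) (λ y → 𝟙 (B y) * 𝟙 (edge G x y)) ⟨
      𝟙 (class F W x) * κ x * deg G B x
        ≡⟨ *-assoc (𝟙 (class F W x)) (κ x) (deg G B x) ⟩
      𝟙 (class F W x) * (κ x * deg G B x)
        ≤⟨ bounded ⟩
      𝟙 (class F W x) * (2 * b) ∎
      where
      bounded : 𝟙 (class F W x) * (κ x * deg G B x) ≤ 𝟙 (class F W x) * (2 * b)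
      bounded with class F W x in x∈W
      ... | false = z≤n
      ... | true with heavy x in h
      ...   | true  = *-monoʳ-≤ 1 (*-monoʳ-≤ 2 (heavy≤ (class-true⁻ F x∈W) h))
      ...   | false = *-monoʳ-≤ 1 (≤-trans (≤-reflexive (*-identityˡ _)) (light≤ (class-true⁻ F x∈W)))

  degB-blocked : ∀ {v} (Q : Fin K → Bool) → S v ≡ true →
                 (∀ c → Q c ≡ true → c ∈ L × ¬ Free G F c v) → count Q + deg G B v < a + b
  degB-blocked {v} Q Sv blk = subst (λ k → k + deg G B v < a + b) (sum-cong-≗ pointwise) (degB-bound (𝟙 ∘ Q) Sv le)
    where
    le : ∀ c → c ∈ L → 𝟙 (Q c) ≤ classDeg G F c v
    le c _ with Q c in Qc
    ... | false = z≤n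
    ... | true  = ¬Free⇒deg≥1 G F (proj₂ (blk c Qc))
    pointwise : ∀ c → 𝟙 (inside L c) * 𝟙 (Q c) ≡ 𝟙 (Q c)
    pointwise c with Q c in Qc
    ... | false = *-zeroʳ (𝟙 (inside L c))
    ... | true  rewrite inside-true (proj₁ (blk c Qc)) = refl

  Stuck : Fin K → Fin n → Set
  Stuck W x = ∀ c → c ∈ L → c ≢ W → ¬ Free G F c x

  Stuck? : ∀ W x → Dec (Stuck W x)
  Stuck? W x with Fin.any? (λ c → c ∈? L ×-dec ¬? (c Fin.≟ W) ×-dec Free? G F c x)
  ... | yes (c , c∈L , c≢W , free) = no λ stuck → stuck c c∈L c≢W free
  ... | no none = yes λ c c∈L c≢W free → none (c , c∈L , c≢W , free)

  -- Of at most `a + b - 1` neighbours, the other `a - 1` classes of `L` take at least one each.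
  stuck⇒degB≤b : ∀ {W x} → W ∈ L → F x ≡ just W → Stuck W x → deg G B x ≤ b
  stuck⇒degB≤b {W} {x} W∈L Fx stuck = s≤s⁻¹ (+-cancelˡ-< (count (inside L ∖ W)) _ _ (begin-strict
    count (inside L ∖ W) + deg G B x    <⟨ degB-blocked (inside L ∖ W) (coloured⇒S Fx) blk ⟩
    a + b                               ≡⟨ cong (_+ b) (count-∖ (inside L) W (inside-true W∈L)) ⟩
    suc (count (inside L ∖ W)) + b      ≡⟨ +-suc _ b ⟨
    count (inside L ∖ W) + suc b        ∎))
    where
    open ≤-Reasoning
    blk : ∀ c → (inside L ∖ W) c ≡ true → c ∈ L × ¬ Free G F c x
    blk c c∈ with c∈L , c≢W ← ∖-true⁻ (inside L) W c∈ = does⇒ (c ∈? L) c∈L , stuck c (does⇒ (c ∈? L) c∈L) c≢W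

  -- If `c₀` were alone in `L`, all its vertices would be stuck for lack of a target; counting all
  -- of them as heavy overloads `c₀`.
  other-class : ∃ λ c → c ∈ L × c ≢ c₀
  other-class with Fin.any? (λ c → c ∈? L ×-dec ¬? (c Fin.≟ c₀))
  ... | yes other = other
  ... | no none = ⊥-elim (overloaded (c₀∈chain chL) (const true) (λ Fx _ → bound Fx)
                    (λ Fx → ≤-trans (bound Fx) (m≤m+n b _)) (λ _ _ _ _ → refl))
    where
    bound : ∀ {x} → F x ≡ just c₀ → deg G B x ≤ b
    bound Fx = stuck⇒degB≤b (c₀∈chain chL) Fx λ c c∈L c≢c₀ → contradiction (c , c∈L , c≢c₀) none

  -- Terminal classes and solo neighbours

  module Terminals (sp : Split G F c₀ L) where

    open Split sp
      using (P; U; U∈P; c₀∈P; P⊆L; terminal) renaming (proper to nonempty; blocked to P-blocked)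

    T : Fin K → Bool
    T c = inside L c ∧ outside P c

    t : ℕ
    t = count T

    T-true⁻ : ∀ {c} → T c ≡ true → c ∈ L × c ∉ P
    T-true⁻ {c} Tc with p , q ← ∧-true {inside L c} Tc = does⇒ (_ ∈? L) p , outside-true⁻ q

    a≡P+t : a ≡ count (inside P) + t
    a≡P+t = trans (sum-cong-≗ pointwise) (sum-+ (𝟙 ∘ inside P) (𝟙 ∘ T))
      where
      pointwise : ∀ c → 𝟙 (inside L c) ≡ 𝟙 (inside P c) + 𝟙 (T c)
      pointwise c with c ∈? P
      ... | yes c∈P rewrite inside-true (P⊆L c c∈P) = refl
      ... | no _    = cong 𝟙 (sym (∧-identityʳ (inside L c)))

    -- All classes of `P` except possibly `U` block `x`, so at least `count (inside P) - 1` of its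
    -- at most `a + b - 1` neighbours lie outside `B`.
    T⇒degB≤t+b : ∀ {W x} → W ∈ L → W ∉ P → F x ≡ just W → deg G B x ≤ t + b
    T⇒degB≤t+b {W} {x} W∈L W∉P Fx = s≤s⁻¹ (+-cancelˡ-< (count (inside P ∖ U)) _ _ (begin-strict
      count (inside P ∖ U) + deg G B x        <⟨ degB-blocked (inside P ∖ U) (coloured⇒S Fx) blk ⟩
      a + b                                   ≡⟨ cong (_+ b) a≡P+t ⟩
      count (inside P) + t + b                ≡⟨ cong (λ k → k + t + b) (count-∖ (inside P) U (inside-true U∈P)) ⟩
      suc (count (inside P ∖ U)) + t + b      ≡⟨ rearrange (count (inside P ∖ U)) t b ⟩
      count (inside P ∖ U) + suc (t + b)      ∎))
      where
      open ≤-Reasoning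
      rearrange : ∀ p t b → suc p + t + b ≡ p + suc (t + b)
      rearrange = solve-∀
      blk : ∀ c → (inside P ∖ U) c ≡ true → c ∈ L × ¬ Free G F c x
      blk c c∈ with c∈P , c≢U ← ∖-true⁻ (inside P) U c∈ =
        P⊆L c (does⇒ (c ∈? P) c∈P) , P-blocked W∈L W∉P Fx (does⇒ (c ∈? P) c∈P) c≢U

    -- The vertex `z` is all that prevents `y` from moving into `W`.
    Solo : Fin K → Fin n → Fin n → Set
    Solo W z y = B y ≡ true × F z ≡ just W × edge G y z ≡ true × classDeg G F W y ≡ 1

    -- Once `y₁` has replaced `z` in `W`, the vertex `y₂` is free to move into `W` as well.
    Crowded : Set
    Crowded = ∃₂ λ W z → ∃₂ λ y₁ y₂ →
              W ∈ L × W ∉ P × y₁ ≢ y₂ × edge G y₂ y₁ ≡ false × Solo W z y₁ × Solo W z y₂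

    -- A counterexample to `solo-stuck` lets `advance-movable` finish at once; what follows treats
    -- the remaining case.
    module _ (solo-stuck : ∀ {W z y} → W ∈ L → W ∉ P → Solo W z y → Stuck W z) where

      -- If `t ≤ b`, every vertex of a class of `T` has at most `t + b ≤ 2 * b` neighbours in `B`,
      -- and the stuck ones, which include all solo neighbours, at most `b`. Taking the stuck
      -- vertices as heavy overloads that class.
      b<t : b < t
      b<t with suc b ≤? t
      ... | yes b<t = b<t
      ... | no b≮t with W , W∈L , W∉P ← nonempty = ⊥-elim (overloaded W∈L (λ x → does (Stuck? W x))
        (λ Fx h → stuck⇒degB≤b W∈L Fx (does⇒ (Stuck? W _) h)) (λ Fx → ≤-trans (T⇒degB≤t+b W∈L W∉P Fx) (≤-trans (+-monoˡ-≤ b (≮⇒≥ b≮t)) (≤-reflexive (cong (b +_) (sym (+-identityʳ b))))))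
        (λ By Fx yx d → dec-true (Stuck? W _) (solo-stuck W∈L W∉P (By , Fx , yx , d))))

      one : Fin K → Fin n → Bool
      one c y = does (classDeg G F c y ≟ 1)

      solos : Fin n → ℕ
      solos y = count (λ c → T c ∧ one c y)

      -- Every class of `L` takes one neighbour of `y`, and a class of `T` in which `y` has no solo
      -- neighbour takes a second; the degree bound limits the number of such classes.
      many-solos : ∀ {y} → B y ≡ true → t + suc (deg G B y) ≤ solos y + b
      many-solos {y} By = +-cancelˡ-≤ a _ _ (begin
        a + (t + suc (deg G B y))
          ≡⟨ cong (λ k → a + (k + suc (deg G B y))) t≡ ⟩
        a + (solos y + others + suc (deg G B y))
          ≡⟨ rearrange a (solos y) others (deg G B y) ⟩
        solos y + suc (a + others + deg G B y)
          ≡⟨ cong (λ k → solos y + suc (k + deg G B y)) (trans (sum-cong-≗ pointwise) (sum-+ (𝟙 ∘ inside L) _)) ⟨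
        solos y + suc (sum (λ c → 𝟙 (inside L c) * f c) + deg G B y)
          ≤⟨ +-monoʳ-≤ (solos y) (degB-bound f (B⊆S y By) f≤) ⟩
        solos y + (a + b)
          ≡⟨ rearrange′ (solos y) a b ⟩
        a + (solos y + b) ∎)
        where
        open ≤-Reasoning
        rearrange : ∀ a x o d → a + (x + o + suc d) ≡ x + suc (a + o + d)
        rearrange = solve-∀
        rearrange′ : ∀ x a b → x + (a + b) ≡ a + (x + b)
        rearrange′ = solve-∀
        f : Fin K → ℕ
        f c = 1 + 𝟙 (T c ∧ not (one c y))
        others = count (λ c → T c ∧ not (one c y))
        t≡ : t ≡ solos y + others
        t≡ = trans (sum-cong-≗ λ c → cases (T c) (one c y)) (sum-+ (λ c → 𝟙 (T c ∧ one c y)) _)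
          where
          cases : ∀ p q → 𝟙 p ≡ 𝟙 (p ∧ q) + 𝟙 (p ∧ not q)
          cases false _     = refl
          cases true  false = refl
          cases true  true  = refl
        pointwise : ∀ c → 𝟙 (inside L c) * f c ≡ 𝟙 (inside L c) + 𝟙 (T c ∧ not (one c y))
        pointwise c with inside L c
        ... | false = refl
        ... | true  = +-identityʳ _
        f≤ : ∀ c → c ∈ L → f c ≤ classDeg G F c y
        f≤ c c∈L with T c | classDeg G F c y | blocked By c∈L
        ... | false | suc _       | _ = s≤s z≤n
        ... | true  | 1           | _ = s≤s z≤n
        ... | true  | suc (suc _) | _ = s≤s (s≤s z≤n)

      module _ (ind : IndependentSubset G B (suc ∘ deg G B)) where

        open IndependentSubset ind

        witnesses : Fin K → Fin n → ℕ
        witnesses W z = count (λ y → I y ∧ (one W y ∧ edge G y z))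

        unpack : ∀ p q r → p ∧ (q ∧ r) ≡ true → p ≡ true × q ≡ true × r ≡ true
        unpack true true true _ = refl , refl , refl

        positive : ∀ p {k l} → 𝟙 p * k < 𝟙 p * l → p ≡ true × k < l
        positive true {k} {l} lt = refl , subst₂ _<_ (*-identityˡ k) (*-identityˡ l) lt

        -- Here `i` is the size of `I`, `D` its total weight and `X` its number of solo incidences.
        -- With `t = b + e` the first inequality says `D + e * i ≤ X`. From `b * s < D ≤ i * b`
        -- follows `s < i`, so `X` exceeds `b * s + e * s`.
        arithmetic : ∀ {i D X} → i * t + D ≤ X + i * b → suc (b * s) ≤ D → D ≤ i * b → t * s < X
        arithmetic {i} {D} {X} le D≥ D≤ with e , t≡ ← m≤n⇒∃[o]m+o≡n (<⇒≤ b<t) = begin-strict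
          t * s                   ≡⟨ cong (_* s) t≡ ⟨
          (b + e) * s             ≡⟨ *-distribʳ-+ s b e ⟩
          b * s + e * s           <⟨ ≤-refl ⟩
          suc (b * s) + e * s     ≤⟨ +-mono-≤ D≥ (*-monoʳ-≤ e s≤i) ⟩
          D + e * i               ≤⟨ +-cancelʳ-≤ (i * b) _ _ (≤-trans (≤-reflexive shuffle) le) ⟩
          X                       ∎
          where
          open ≤-Reasoning
          s≤i : s ≤ i
          s≤i = <⇒≤ (*-cancelˡ-< b s i (≤-trans D≥ (≤-trans D≤ (≤-reflexive (*-comm i b)))))
          identity : ∀ D e i b → D + e * i + i * b ≡ i * (b + e) + D
          identity = solve-∀
          shuffle : D + e * i + i * b ≡ i * t + D
          shuffle = trans (identity D e i b) (cong (λ k → i * k + D) t≡)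

        Σ-I-const : ∀ k → Σ⟨ I ⟩ (const k) ≡ count I * k
        Σ-I-const k = sym (*-distribʳ-sum k (𝟙 ∘ I))

        Σ-I-+ : ∀ (f g : Fin n → ℕ) → Σ⟨ I ⟩ (λ y → f y + g y) ≡ Σ⟨ I ⟩ f + Σ⟨ I ⟩ g
        Σ-I-+ f g = trans (sum-cong-≗ λ y → *-distribˡ-+ (𝟙 (I y)) (f y) (g y)) (sum-+ (λ y → 𝟙 (I y) * f y) _)

        Σ-I-mono : ∀ {f g : Fin n → ℕ} → (∀ y → B y ≡ true → f y ≤ g y) → Σ⟨ I ⟩ f ≤ Σ⟨ I ⟩ g
        Σ-I-mono {f} {g} f≤g = sum-mono-≤ le
          where
          le : ∀ y → 𝟙 (I y) * f y ≤ 𝟙 (I y) * g y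
          le y with I y in Iy
          ... | false = z≤n
          ... | true  = *-monoʳ-≤ 1 (f≤g y (subset y Iy))

        solos≡ : ∀ y → solos y ≡ sum (λ c → 𝟙 (T c) * 𝟙 (one c y))
        solos≡ y = sum-cong-≗ λ c → 𝟙-∧ (T c) (one c y)

        exchange-order : ∀ i t o → i * (t * o) ≡ t * (i * o)
        exchange-order = solve-∀

        -- The members of I have more than ts solo neighbours in total, but the t classes of T
        -- contain only ts vertices, so two members of I share one.
        total : sum (λ c → 𝟙 (T c) * s) < sum (λ c → 𝟙 (T c) * Σ⟨ I ⟩ (𝟙 ∘ one c))
        total = begin-strict
          sum (λ c → 𝟙 (T c) * s)
            ≡⟨ *-distribʳ-sum s (𝟙 ∘ T) ⟨
          t * s
            <⟨ arithmetic {i = count I} (begin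
                 count I * t + Σ⟨ I ⟩ (suc ∘ deg G B)
                   ≡⟨ cong (_+ Σ⟨ I ⟩ (suc ∘ deg G B)) (Σ-I-const t) ⟨
                 Σ⟨ I ⟩ (const t) + Σ⟨ I ⟩ (suc ∘ deg G B)
                   ≡⟨ Σ-I-+ (const t) (suc ∘ deg G B) ⟨
                 Σ⟨ I ⟩ (λ y → t + suc (deg G B y))
                   ≤⟨ Σ-I-mono (λ y → many-solos) ⟩
                 Σ⟨ I ⟩ (λ y → solos y + b)
                   ≡⟨ Σ-I-+ solos (const b) ⟩
                 Σ⟨ I ⟩ solos + Σ⟨ I ⟩ (const b)
                   ≡⟨ cong (Σ⟨ I ⟩ solos +_) (Σ-I-const b) ⟩
                 Σ⟨ I ⟩ solos + count I * b ∎)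
               (≤-trans (≤-reflexive (sym count-B)) large)
               (≤-trans (Σ-I-mono (λ y → degB<b)) (≤-reflexive (Σ-I-const b))) ⟩
          Σ⟨ I ⟩ solos
            ≡⟨ sum-cong-≗ (λ y → trans (cong (𝟙 (I y) *_) (solos≡ y))
                 (*-distribˡ-sum (𝟙 (I y)) (λ c → 𝟙 (T c) * 𝟙 (one c y)))) ⟩
          sum (λ y → sum (λ c → 𝟙 (I y) * (𝟙 (T c) * 𝟙 (one c y))))
            ≡⟨ ∑-comm (λ y c → 𝟙 (I y) * (𝟙 (T c) * 𝟙 (one c y))) ⟩
          sum (λ c → sum (λ y → 𝟙 (I y) * (𝟙 (T c) * 𝟙 (one c y))))
            ≡⟨ sum-cong-≗ (λ c → trans (sum-cong-≗ λ y → exchange-order (𝟙 (I y)) (𝟙 (T c)) (𝟙 (one c y)))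
                 (sym (*-distribˡ-sum (𝟙 (T c)) (λ y → 𝟙 (I y) * 𝟙 (one c y))))) ⟩
          sum (λ c → 𝟙 (T c) * Σ⟨ I ⟩ (𝟙 ∘ one c)) ∎
          where open ≤-Reasoning

        -- Each member of `I` with just one neighbour in `W` is counted exactly once, at that
        -- neighbour.
        spread : ∀ {W} → W ∈ L → W ∉ P → s < Σ⟨ I ⟩ (𝟙 ∘ one W) →
                 size F W < sum (λ z → 𝟙 (class F W z) * witnesses W z)
        spread {W} W∈L W∉P lt = begin-strict
          size F W
            ≤⟨ size≤s W∈L ⟩
          s
            <⟨ lt ⟩
          Σ⟨ I ⟩ (𝟙 ∘ one W)
            ≡⟨ sum-cong-≗ neighbour ⟩
          sum (λ y → sum (λ z → 𝟙 (class F W z) * 𝟙 (I y ∧ (one W y ∧ edge G y z))))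
            ≡⟨ ∑-comm (λ y z → 𝟙 (class F W z) * 𝟙 (I y ∧ (one W y ∧ edge G y z))) ⟩
          sum (λ z → sum (λ y → 𝟙 (class F W z) * 𝟙 (I y ∧ (one W y ∧ edge G y z))))
            ≡⟨ sum-cong-≗ (λ z → *-distribˡ-sum (𝟙 (class F W z)) (λ y → 𝟙 (I y ∧ (one W y ∧ edge G y z)))) ⟨
          sum (λ z → 𝟙 (class F W z) * witnesses W z) ∎
          where
          open ≤-Reasoning
          neighbour : ∀ y → 𝟙 (I y) * 𝟙 (one W y) ≡
                      sum (λ z → 𝟙 (class F W z) * 𝟙 (I y ∧ (one W y ∧ edge G y z)))
          neighbour y with I y | one W y in o
          ... | false | _     = sym (sum-zero λ z → *-zeroʳ (𝟙 (class F W z)))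
          ... | true  | false = sym (sum-zero λ z → *-zeroʳ (𝟙 (class F W z)))
          ... | true  | true  = sym (does⇒ (classDeg G F W y ≟ 1) o)

        crowded-class : ∃ λ W → W ∈ L × W ∉ P × s < Σ⟨ I ⟩ (𝟙 ∘ one W)
        crowded-class = pick (sum<⇒∃< _ _ total)
          where
          pick : (∃ λ c → 𝟙 (T c) * s < 𝟙 (T c) * Σ⟨ I ⟩ (𝟙 ∘ one c)) → _
          pick (W , lt) = W , proj₁ (T-true⁻ (proj₁ both)) , proj₂ (T-true⁻ (proj₁ both)) , proj₂ both
            where
            both : T W ≡ true × s < Σ⟨ I ⟩ (𝟙 ∘ one W)
            both = positive (T W) lt

        crowded-vertex : ∀ {W} → W ∈ L → W ∉ P → s < Σ⟨ I ⟩ (𝟙 ∘ one W) →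
                         ∃ λ z → F z ≡ just W × 2 ≤ witnesses W z
        crowded-vertex {W} W∈L W∉P lt = pick (sum<⇒∃< _ _ (spread W∈L W∉P lt))
          where
          pick : (∃ λ z → 𝟙 (class F W z) < 𝟙 (class F W z) * witnesses W z) → _
          pick (z , lt) = z , class-true⁻ F (proj₁ both) , proj₂ both
            where
            both : class F W z ≡ true × 1 < witnesses W z
            both = positive (class F W z) (subst (_< 𝟙 (class F W z) * witnesses W z) (sym (*-identityʳ _)) lt)

        crowded-pair : ∀ {W z} → W ∈ L → W ∉ P → F z ≡ just W → 2 ≤ witnesses W z → Crowded
        crowded-pair {W} {z} W∈L W∉P Fz two = pick (count-≥2 _ two)
          where
          unpacked : ∀ {y} → I y ∧ (one W y ∧ edge G y z) ≡ true → I y ≡ true × one W y ≡ true × edge G y z ≡ true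
          unpacked {y} = unpack (I y) (one W y) (edge G y z)
          solo : ∀ {y} → I y ≡ true × one W y ≡ true × edge G y z ≡ true → Solo W z y
          solo {y} (Iy , o , e) = subset y Iy , Fz , e , does⇒ (_ ≟ 1) o
          pick : (∃₂ λ y₁ y₂ → y₁ ≢ y₂ × I y₁ ∧ (one W y₁ ∧ edge G y₁ z) ≡ true ×
                                         I y₂ ∧ (one W y₂ ∧ edge G y₂ z) ≡ true) → Crowded
          pick (y₁ , y₂ , y₁≢y₂ , p₁ , p₂) =
            W , z , y₁ , y₂ , W∈L , W∉P , y₁≢y₂ ,
            independent y₂ y₁ (y₁≢y₂ ∘ sym) (proj₁ (unpacked p₂)) (proj₁ (unpacked p₁)) ,
            solo (unpacked p₁) , solo (unpacked p₂)

        crowded : Crowded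
        crowded =
          let W , W∈L , W∉P , lt = crowded-class
              z , Fz , two = crowded-vertex W∈L W∉P lt
          in crowded-pair W∈L W∉P Fz two

    SoloMovable : Set
    SoloMovable = ∃₂ λ W z → ∃₂ λ y X → W ∈ L × W ∉ P × Solo W z y × X ∈ L × X ≢ W × Free G F X z

    solo-movable? : Dec SoloMovable
    solo-movable? = Fin.any? λ W → Fin.any? λ z → Fin.any? λ y → Fin.any? λ X →
      W ∈? L ×-dec ¬? (W ∈? P) ×-dec
      (B y ≟ᵇ true ×-dec F z ≟ᶜ just W ×-dec edge G y z ≟ᵇ true ×-dec classDeg G F W y ≟ 1) ×-dec
      X ∈? L ×-dec ¬? (X Fin.≟ W) ×-dec Free? G F X z

    ∉P⇒≢c₀ : ∀ {W} → W ∉ P → W ≢ c₀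
    ∉P⇒≢c₀ W∉P refl = W∉P c₀∈P

    terminal-chain : ∀ {y z W} (sw : Swap y z W) (tm : Terminal G F c₀ L W) →
                     Chain G (Swap.colour sw) c₀ (Terminal.chain tm)
    terminal-chain sw tm =
      Chain-transport (λ c c∈ → agree c (proj₁ (within c c∈)) (proj₂ (within c c∈))) isChain
      where
      open Swap sw
      open Terminal tm

    Free-swap : ∀ {y z W X x} (sw : Swap y z W) → X ∈ L → X ≢ W → Free G F X x → Free G (Swap.colour sw) X x
    Free-swap sw X∈L X≢W free u p = free u (proj₂ (Swap.agree sw _ X∈L X≢W u) p)

    -- Because `W` is terminal, `X` still reaches `c₀` after the swap, and the displaced `z` can be
    -- inserted there.
    advance-movable : ∀ {y z W X} → Swap y z W → Terminal G F c₀ L W → X ∈ L → X ≢ W → Free G F X z →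
                      Equitable s G S C
    advance-movable sw tm X∈L X≢W free =
      insert-along (terminal-chain sw tm) (Swap.isNear sw) (Terminal.covers tm _ X∈L X≢W) (Free-swap sw X∈L X≢W free)

    -- The outer loop, to be re-entered with the same hole and a chain of more classes.
    Continue : Set
    Continue = ∀ {F′ w′ L′} → Near s G S C F′ w′ c₀ → Chain G F′ c₀ L′ →
               count (outside L′) < count (outside L) → Equitable s G S C

    -- The class `W` rejoins the chain through `t`, which is still in it as `t ≢ z`. Then the new
    -- class `d` of `y₂` joins: `y₂` has lost its only neighbour `z` in `W` and is not adjacent to
    -- the newcomer `y₁`. Since `d` was outside `L`, this is progress.
    advance-crowded : ∀ {y₁ y₂ z W t Y} → Continue → W ∈ L → Swap y₁ z W → Terminal G F c₀ L W →
                      y₁ ≢ y₂ → edge G y₂ y₁ ≡ false → Solo W z y₂ →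
                      F t ≡ just W → Y ∈ L → Y ≢ W → Free G F Y t → t ≢ z → Equitable s G S C
    advance-crowded {y₁} {y₂} {z} {W} continue W∈L sw tm y₁≢y₂ y₂y₁ (B₂ , Fz , y₂z , d₂) Ft Y∈L Y≢W free t≢z =
      continue isNear
        (step (step (terminal-chain sw tm) (λ W∈ → proj₂ (within W W∈) refl) (keeps t≢z Ft)
                (covers _ Y∈L Y≢W) (Free-swap sw Y∈L Y≢W free))
          d∉ (proj₂ (proj₂ y₂-outside)) (here refl) y₂-free)
        (outside-< L⊆ (here refl) d∉L)
      where
      open Swap sw
      open Terminal tm
      y₂-outside : ∃ λ c → c ∉ L × colour y₂ ≡ just c
      y₂-outside = outer B₂ (y₁≢y₂ ∘ sym)
      d : Fin K
      d = proj₁ y₂-outside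
      d∉L : d ∉ L
      d∉L = proj₁ (proj₂ y₂-outside)
      d∉ : d ∉ W ∷ chain
      d∉ (here d≡W) = d∉L (subst (_∈ L) (sym d≡W) W∈L)
      d∉ (there d∈) = d∉L (proj₁ (within d d∈))
      y₂-free : Free G colour W y₂
      y₂-free u p with gains p
      ... | inj₁ refl        = y₂y₁
      ... | inj₂ (u≢z , Fu)  = deg≡1⇒unique G (class F W) d₂ (class-true F Fz) (class-true F Fu) y₂z (u≢z ∘ sym)
      L⊆ : ∀ c → c ∈ L → c ∈ d ∷ W ∷ chain
      L⊆ c c∈L with c Fin.≟ W
      ... | yes refl = there (here refl)
      ... | no c≢W   = there (there (covers c c∈L c≢W))

    advance : Continue → Equitable s G S C
    advance continue = decide solo-movable?
      where
      decide : Dec SoloMovable → Equitable s G S C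
      decide (yes (W , z , y , X , W∈L , W∉P , (By , Fz , yz , d≡1) , X∈L , X≢W , free)) =
        advance-movable (swap By W∈L (∉P⇒≢c₀ W∉P) Fz yz d≡1) (terminal W W∈L W∉P) X∈L X≢W free
      decide (no none) = finish (crowded solo-stuck (independent-subset G B))
        where
        solo-stuck : ∀ {W z y} → W ∈ L → W ∉ P → Solo W z y → Stuck W z
        solo-stuck W∈L W∉P solo X X∈L X≢W free = none (_ , _ , _ , X , W∈L , W∉P , solo , X∈L , X≢W , free)
        finish : Crowded → Equitable s G S C
        finish (W , z , y₁ , y₂ , W∈L , W∉P , y₁≢y₂ , y₂y₁ , solo₁@(B₁ , Fz , y₁z , d₁) , solo₂) =
          move (chain-exit chL W∈L (∉P⇒≢c₀ W∉P))
          where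
          move : (∃₂ λ t Y → F t ≡ just W × Y ∈ L × Y ≢ W × Free G F Y t) → Equitable s G S C
          move (t , Y , Ft , Y∈L , Y≢W , free) =
            advance-crowded continue W∈L (swap B₁ W∈L (∉P⇒≢c₀ W∉P) Fz y₁z d₁) (terminal W W∈L W∉P)
              y₁≢y₂ y₂y₁ solo₂ Ft Y∈L Y≢W free
              -- The vertex `t` can move while `z` is stuck, so they differ.
              λ { refl → solo-stuck W∈L W∉P solo₁ Y Y∈L Y≢W free }

-- Placing the uncoloured vertex, and the Hajnal-Szemerédi induction

augment : ∀ {n K s N : ℕ} (G : Graph n) (S : Fin n → Bool) (C : Fin K → Bool) →
          (∀ v → S v ≡ true → deg G S v < N) → count C ≡ N →
          (∀ {N′} → N′ < N → EquitableColourings n K s N′) →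
          ∀ {F w c₀} → Near s G S C F w c₀ → Equitable s G S C
augment {n} {K} {s} G S C deg<N countC colourings near = go near start (<-wellFounded _)
  where
  -- The measure is the number of classes outside the chain; closing the chain first can only lower
  -- it.
  go : ∀ {F w c₀ L} → Near s G S C F w c₀ → Chain G F c₀ L → Acc _<_ (count (outside L)) → Equitable s G S C
  go {F} {w} {c₀} {L} near ch (acc rec) =
    decide (Fin.any? λ X → X ∈? chain ×-dec Free? G F X w)
    where
    open Closure (close {Q = λ _ → ⊤} (λ _ → yes tt) ch)
    outside≤ : count (outside chain) ≤ count (outside L)
    outside≤ = sum-mono-≤ le
      where
      le : ∀ c → 𝟙 (outside chain c) ≤ 𝟙 (outside L c)
      le c with c ∈? L
      ... | yes c∈L = ≤-reflexive (cong 𝟙 (outside-false (extends c c∈L)))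
      ... | no _    = 𝟙≤1 _
    decide : Dec (∃ λ X → X ∈ chain × Free G F X w) → Equitable s G S C
    decide (yes (X , X∈ , free)) = insert-along isChain near X∈ free
    decide (no none) = Terminals.advance (split isChain (proj₁ (proj₂ other-class)) (proj₂ (proj₂ other-class)))
      λ near′ ch′ lt → go near′ ch′ (rec (<-≤-trans lt outside≤))
      where
      open Blocked near isChain (λ X∉ → closed tt X∉) (λ Y∈ free → none (_ , Y∈ , free)) deg<N countC colourings

-- This supplies the colouring of the edgeless graph, where only the class sizes matter: each vertex
-- goes to any colour with capacity left.
distribute : ∀ m (S : Fin n → Bool) (capacity : Fin K → ℕ) → count S ≡ m → sum capacity ≡ m →
             Σ (Colouring n K) λ F → (∀ v → is-just (F v) ≡ S v) × (∀ c → size F c ≡ capacity c)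
distribute {n} zero S capacity count≡ sum≡ = const nothing , dom , λ c →
  trans (sum-zero {n} {𝟙 ∘ class (const nothing) c} λ _ → refl) (sym (n≤0⇒n≡0 (≤-trans (term≤sum capacity c) (≤-reflexive sum≡))))
  where
  dom : ∀ v → false ≡ S v
  dom v = sym (¬-not λ Sv → contradiction
    (≤-trans (≤-reflexive (cong 𝟙 (sym Sv))) (≤-trans (term≤sum (𝟙 ∘ S) v) (≤-reflexive count≡))) λ ())
distribute {n} {K} (suc m) S capacity count≡ sum≡
  with v , Sv ← count-≥1 S (≤-trans (s≤s z≤n) (≤-reflexive (sym count≡)))
  with c , pos ← sum<⇒∃< capacity (const 0)
                   (≤-trans (s≤s (≤-reflexive (sum-zero {K} {const 0} λ _ → refl)))
                     (≤-trans (s≤s z≤n) (≤-reflexive (sym sum≡))))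
  with capacity c in cap-c | pos
... | suc k | _
  with F , dom , sizes ← distribute m (S ∖ v) (capacity [ c ≔ k ])
         (suc-injective (trans (sym (count-∖ S v Sv)) count≡))
         (suc-injective (+-cancelʳ-≡ k _ _ (trans (sym (+-suc _ k))
           (trans (cong (sum (capacity [ c ≔ k ]) +_) (sym cap-c))
             (trans (sum-differ (capacity [ c ≔ k ]) capacity c (λ u → ≔-other capacity))
               (cong₂ _+_ sum≡ (≔-same capacity c)))))))
  = F [ v ≔ just c ] , dom′ , sizes′
  where
  Fv : F v ≡ nothing
  Fv = is-just-false (trans (dom v) (∖-same S v))
  dom′ : ∀ u → is-just ((F [ v ≔ just c ]) u) ≡ S u
  dom′ u with u Fin.≟ v
  ... | yes refl = sym Sv
  ... | no u≢v   = trans (dom u) (∖-other S v u≢v)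
  sizes′ : ∀ d → size (F [ v ≔ just c ]) d ≡ capacity d
  sizes′ d with d Fin.≟ c
  ... | yes refl = trans (size-≔-just F c Fv) (trans (cong suc (trans (sizes c) (≔-same capacity c))) (sym cap-c))
  ... | no d≢c   = trans (size-≔-other F d (λ p → just≢nothing p Fv) (d≢c ∘ sym ∘ just-injective))
                     (trans (sizes d) (≔-other capacity d≢c))

restrict : Graph n → (Fin n → Bool) → Graph n
restrict G R = record
  { edge   = λ u v → edge G u v ∧ (R u ∧ R v)
  ; symm   = λ u v → cong₂ _∧_ (symm G u v) (∧-comm (R u) (R v))
  ; irrefl = λ v → cong (_∧ (R v ∧ R v)) (irrefl G v) }

restrict-deg : ∀ (G : Graph n) R S v → deg (restrict G R) S v ≤ deg G S v
restrict-deg G R S v = sum-mono-≤ λ u → *-monoʳ-≤ (𝟙 (S u)) (le (edge G v u))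
  where
  le : ∀ a {b} → 𝟙 (a ∧ b) ≤ 𝟙 a
  le true  = 𝟙≤1 _
  le false = z≤n

-- Hajnal–Szemerédi. The edges are switched on one vertex at a time; the new vertex is
-- uncoloured and the colouring is repaired.
equitable-colouring : ∀ {n K} s N → EquitableColourings n K s N
equitable-colouring {n} {K} s N = go N (<-wellFounded N)
  where
  go : ∀ N → Acc _<_ N → EquitableColourings n K s N
  go N (acc rec) G S C countC countS deg<N = record
    { colour = colour ; domain = domain ; range = range ; sizes = sizes
    ; proper = λ {u} {v} p q → trans (sym (unrestricted u v)) (proper p q) }
    where
    unrestricted : ∀ u v → edge (restrict G (inside (allFin n))) u v ≡ edge G u v
    unrestricted u v = trans (cong₂ (λ p q → edge G u v ∧ (p ∧ q)) (inside-true (∈-allFin u)) (inside-true (∈-allFin v)))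
      (∧-identityʳ _)
    inside-other : ∀ {u v} {vs : List (Fin n)} → u ≢ v → inside (v ∷ vs) u ≡ inside vs u
    inside-other {u} {v} {vs} u≢v rewrite dec-false (u Fin.≟ v) u≢v = refl
    restrict-other : ∀ {u u′ v vs} → u ≢ v → u′ ≢ v →
                     edge (restrict G (inside (v ∷ vs))) u u′ ≡ edge (restrict G (inside vs)) u u′
    restrict-other {u} {u′} {vs = vs} u≢v u′≢v = cong₂ (λ p q → edge G u u′ ∧ (p ∧ q)) (inside-other {vs = vs} u≢v) (inside-other {vs = vs} u′≢v)
    build : ∀ vs → Equitable s (restrict G (inside vs)) S C
    build [] with F , dom , sizes ← distribute (N * s) S (λ c → 𝟙 (C c) * s) countS
                    (trans (sym (*-distribʳ-sum s (𝟙 ∘ C))) (cong (_* s) countC)) = record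
      { colour = F ; domain = dom ; range = range
      ; proper = λ {u} {v} _ _ → ∧-zeroʳ (edge G u v)
      ; sizes = λ c Cc → trans (sizes c) (trans (cong (λ b → 𝟙 b * s) Cc) (*-identityˡ s)) }
      where
      range : ∀ {v c} → F v ≡ just c → C c ≡ true
      range {v} {c} Fv with C c in Cc
      ... | true  = refl
      ... | false = contradiction (≤-trans (≤-reflexive (cong 𝟙 (sym (class-true F Fv))))
                      (≤-trans (term≤sum (𝟙 ∘ class F c) v)
                        (≤-reflexive (trans (sizes c) (cong (λ b → 𝟙 b * s) Cc))))) λ ()
    build (v ∷ vs) with build vs
    ... | record { colour = F ; domain = dom ; range = range ; proper = proper ; sizes = sizes } = extend (S v) refl
      where
      extend : ∀ b → S v ≡ b → Equitable s (restrict G (inside (v ∷ vs))) S C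
      extend false Sv = record
        { colour = F ; domain = dom ; range = range ; sizes = sizes
        ; proper = λ p q → trans (restrict-other {vs = vs} (≢v p) (≢v q)) (proper p q) }
        where
        ≢v : ∀ {u c} → F u ≡ just c → u ≢ v
        ≢v Fu refl = just≢nothing Fu (is-just-false (trans (dom v) Sv))
      extend true Sv with c₀ , Fv ← is-just-true (trans (dom v) Sv) =
        augment (restrict G (inside (v ∷ vs))) S C
          (λ u Su → ≤-<-trans (restrict-deg G (inside (v ∷ vs)) S u) (deg<N u Su)) countC
          (λ N′<N → go _ (rec N′<N)) near
        where
        -- Switching on the edges at `v` changes nothing between other vertices, so without `v` the
        -- colouring is still proper, with the hole in the former class of `v`.
        F′ = F [ v ≔ nothing ]
        F′⁻ : ∀ {u c} → F′ u ≡ just c → u ≢ v × F u ≡ just c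
        F′⁻ {u} eq with u Fin.≟ v
        F′⁻ () | yes _
        F′⁻ eq | no u≢v = u≢v , eq
        near : Near s (restrict G (inside (v ∷ vs))) S C F′ v c₀
        near = record
          { w∈S = Sv ; w-blank = ≔-same F v
          ; domain = λ u u≢v → trans (cong is-just (≔-other F u≢v)) (dom u)
          ; range = λ p → range (proj₂ (F′⁻ p))
          ; proper = λ p q → trans (restrict-other {vs = vs} (proj₁ (F′⁻ p)) (proj₁ (F′⁻ q)))
                               (proper (proj₂ (F′⁻ p)) (proj₂ (F′⁻ q)))
          ; c₀∈C = range Fv
          ; size₀ = trans (size-≔-nothing F c₀ Fv) (sizes c₀ (range Fv))
          ; sizes = λ c Cc c≢c₀ → trans (size-≔-other F c (λ p → c≢c₀ (colour-unique p Fv)) λ ()) (sizes c Cc) }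
    open Equitable (build (allFin n))

-- Triangle factors and 4-triangles

∑⟨_⟩ : Triple n → (Fin n → ℕ) → ℕ
∑⟨ x , y , z ⟩ φ = φ x + φ y + φ z

Σ⟨⟩-∖ : ∀ (P : Fin n → Bool) {x} φ → P x ≡ true → Σ⟨ P ⟩ φ ≡ φ x + Σ⟨ P ∖ x ⟩ φ
Σ⟨⟩-∖ P {x} φ Px = begin
  Σ⟨ P ⟩ φ                                ≡⟨ +-identityʳ _ ⟨
  Σ⟨ P ⟩ φ + 0                            ≡⟨ cong (λ b → Σ⟨ P ⟩ φ + 𝟙 b * φ x) (∖-same P x) ⟨
  Σ⟨ P ⟩ φ + 𝟙 ((P ∖ x) x) * φ x          ≡⟨ sum-differ _ _ x (λ u u≢x → cong (λ b → 𝟙 b * φ u) (sym (∖-other P x u≢x))) ⟩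
  Σ⟨ P ∖ x ⟩ φ + 𝟙 (P x) * φ x            ≡⟨ cong (λ b → Σ⟨ P ∖ x ⟩ φ + 𝟙 b * φ x) Px ⟩
  Σ⟨ P ∖ x ⟩ φ + 1 * φ x                  ≡⟨ cong (Σ⟨ P ∖ x ⟩ φ +_) (*-identityˡ (φ x)) ⟩
  Σ⟨ P ∖ x ⟩ φ + φ x                      ≡⟨ +-comm _ (φ x) ⟩
  φ x + Σ⟨ P ∖ x ⟩ φ                      ∎
  where open ≡-Reasoning

count≡0⇒Σ⟨⟩≡0 : ∀ (P : Fin n → Bool) φ → count P ≡ 0 → Σ⟨ P ⟩ φ ≡ 0
count≡0⇒Σ⟨⟩≡0 P φ c≡0 = sum-zero λ i →
  cong (_* φ i) (n≤0⇒n≡0 (≤-trans (term≤sum (𝟙 ∘ P) i) (≤-reflexive c≡0)))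

-- The field `all` says that the list is complete, in the form that `Partition` asks for.
record Members (P : Fin n → Bool) : Set where
  field
    {x y z} : Fin n
    x∈  : P x ≡ true
    y∈  : P y ≡ true
    z∈  : P z ≡ true
    x≢y : x ≢ y
    y≢z : y ≢ z
    x≢z : x ≢ z
    all : ∀ φ → Σ⟨ P ⟩ φ ≡ ∑⟨ x , y , z ⟩ φ

count≡3⇒members : ∀ (P : Fin n → Bool) → count P ≡ 3 → Members P
count≡3⇒members P c≡3
  with x , Px ← count-≥1 P (≤-trans (s≤s z≤n) (≤-reflexive (sym c≡3)))
  with c≡2 ← suc-injective (trans (sym (count-∖ P x Px)) c≡3)
  with y , Py ← count-≥1 (P ∖ x) (≤-trans (s≤s z≤n) (≤-reflexive (sym c≡2)))
  with c≡1 ← suc-injective (trans (sym (count-∖ (P ∖ x) y Py)) c≡2)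
  with z , Pz ← count-≥1 ((P ∖ x) ∖ y) (≤-reflexive (sym c≡1))
  with c≡0 ← suc-injective (trans (sym (count-∖ ((P ∖ x) ∖ y) z Pz)) c≡1)
  with Pz′ , z≢y ← ∖-true⁻ (P ∖ x) y Pz
  with Py′ , y≢x ← ∖-true⁻ P x Py | Pz″ , z≢x ← ∖-true⁻ P x Pz′ = record
  { x∈ = Px ; y∈ = Py′ ; z∈ = Pz″ ; x≢y = y≢x ∘ sym ; y≢z = z≢y ∘ sym ; x≢z = z≢x ∘ sym ; all = all }
  where
  all : ∀ φ → Σ⟨ P ⟩ φ ≡ φ x + φ y + φ z
  all φ = begin
    Σ⟨ P ⟩ φ                                              ≡⟨ Σ⟨⟩-∖ P φ Px ⟩
    φ x + Σ⟨ P ∖ x ⟩ φ                                    ≡⟨ cong (φ x +_) (Σ⟨⟩-∖ (P ∖ x) φ Py) ⟩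
    φ x + (φ y + Σ⟨ (P ∖ x) ∖ y ⟩ φ)                      ≡⟨ cong (λ k → φ x + (φ y + k)) (Σ⟨⟩-∖ ((P ∖ x) ∖ y) φ Pz) ⟩
    φ x + (φ y + (φ z + Σ⟨ ((P ∖ x) ∖ y) ∖ z ⟩ φ))        ≡⟨ cong (λ k → φ x + (φ y + (φ z + k)))
                                                              (count≡0⇒Σ⟨⟩≡0 (((P ∖ x) ∖ y) ∖ z) φ c≡0) ⟩
    φ x + (φ y + (φ z + 0))                               ≡⟨ regroup (φ x) (φ y) (φ z) ⟩
    φ x + φ y + φ z                                       ∎
    where
    open ≡-Reasoning
    regroup : ∀ a b c → a + (b + (c + 0)) ≡ a + b + c
    regroup = solve-∀

-- A family of triples partitions the vertices iff summing over the triples is the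
-- same as summing over the vertices.
Partition : ∀ {n k} → (Fin k → Triple n) → Set
Partition {n} T = ∀ φ → sum {n} φ ≡ sum (λ c → ∑⟨ T c ⟩ φ)

Triangle : Multigraph n → Triple n → Set
Triangle M (x , y , z) = Adjacent M x y × Adjacent M y z × Adjacent M x z

weight : Multigraph n → Triple n → ℕ
weight M (x , y , z) = μ M x y + μ M y z + μ M x z

non-adjacency : Multigraph n → Graph n
non-adjacency M = record
  { edge   = λ x y → not (does (x Fin.≟ y)) ∧ does (μ M x y ≟ 0)
  ; symm   = symmetric
  ; irrefl = λ x → cong (λ b → not b ∧ does (μ M x x ≟ 0)) (dec-true (x Fin.≟ x) refl) }
  where
  symmetric : ∀ x y → not (does (x Fin.≟ y)) ∧ does (μ M x y ≟ 0) ≡ not (does (y Fin.≟ x)) ∧ does (μ M y x ≟ 0)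
  symmetric x y rewrite μ-sym M x y with x Fin.≟ y
  ... | yes refl rewrite dec-true (x Fin.≟ x) refl = refl
  ... | no x≢y rewrite dec-false (y Fin.≟ x) (x≢y ∘ sym) = refl

non-edge⇒adjacent : ∀ (M : Multigraph n) {x y} → x ≢ y → edge (non-adjacency M) x y ≡ false → Adjacent M x y
non-edge⇒adjacent M {x} {y} x≢y e with μ M x y
... | suc _ = s≤s z≤n
... | zero rewrite dec-false (x Fin.≟ y) x≢y with () ← e

-- Of a budget of 2 for each of the `3k` vertices, `x` itself and each non-neighbour waste 2. So the
-- degree is at most `6k - 2 - 2d`, and being at least `4k - 1` it forces `d < k`.
non-adjacency-deg : ∀ {k} (M : Multigraph (k * 3)) → Standard M → (∀ x → 4 * k ≤ suc (degree M x)) →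
                    ∀ x → deg (non-adjacency M) (const true) x < k
non-adjacency-deg {k} M standard dense x =
  conclude {d = d} {D = degree M x} {k} (dense x) (begin
    2 * d + 2 + degree M x
      ≡⟨ cong₂ (λ p q → p + q + degree M x) (*-distribˡ-sum 2 (λ y → 1 * 𝟙 (edge H x y))) (sym (sum-at (const 2) x)) ⟩
    sum (λ y → 2 * (1 * 𝟙 (edge H x y))) + sum (λ y → 𝟙 (does (y Fin.≟ x)) * 2) + sum (μ M x)
      ≡⟨ cong (_+ sum (μ M x)) (sum-+ (λ y → 2 * (1 * 𝟙 (edge H x y))) _) ⟨
    sum (λ y → 2 * (1 * 𝟙 (edge H x y)) + 𝟙 (does (y Fin.≟ x)) * 2) + sum (μ M x)
      ≡⟨ sum-+ (λ y → 2 * (1 * 𝟙 (edge H x y)) + 𝟙 (does (y Fin.≟ x)) * 2) (μ M x) ⟨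
    sum (λ y → 2 * (1 * 𝟙 (edge H x y)) + 𝟙 (does (y Fin.≟ x)) * 2 + μ M x y)
      ≤⟨ sum-mono-≤ pointwise ⟩
    sum {k * 3} (const 2)
      ≡⟨ sum-const (k * 3) 2 ⟩
    k * 3 * 2 ∎)
  where
  open ≤-Reasoning
  H = non-adjacency M
  d = deg H (const true) x
  pointwise : ∀ y → 2 * (1 * 𝟙 (edge H x y)) + 𝟙 (does (y Fin.≟ x)) * 2 + μ M x y ≤ 2
  pointwise y with x Fin.≟ y
  ... | yes refl rewrite dec-true (x Fin.≟ x) refl | μ-loop M x = ≤-refl
  ... | no x≢y rewrite dec-false (y Fin.≟ x) (x≢y ∘ sym) with μ M x y | standard x y
  ...   | zero  | _ = ≤-refl
  ...   | suc _ | p = p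
  conclude : ∀ {d D k} → 4 * k ≤ suc D → 2 * d + 2 + D ≤ k * 3 * 2 → d < k
  conclude {d} {D} {k} p q with suc d ≤? k
  ... | yes d<k = d<k
  ... | no d≮k = contradiction (+-cancelʳ-≤ (6 * k + D) 2 1 (begin
    2 + (6 * k + D)                       ≡⟨ e₁ k D ⟩
    2 * k + 2 + D + 4 * k                 ≤⟨ +-monoˡ-≤ (4 * k) (+-monoˡ-≤ D (+-monoˡ-≤ 2 (*-monoʳ-≤ 2 (≮⇒≥ d≮k)))) ⟩
    2 * d + 2 + D + 4 * k                 ≤⟨ +-mono-≤ q p ⟩
    k * 3 * 2 + suc D                     ≡⟨ e₂ k D ⟩
    1 + (6 * k + D)                       ∎)) λ { (s≤s ()) }
    where
    e₁ : ∀ k D → 2 + (6 * k + D) ≡ 2 * k + 2 + D + 4 * k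
    e₁ = solve-∀
    e₂ : ∀ k D → k * 3 * 2 + suc D ≡ 1 + (6 * k + D)
    e₂ = solve-∀

-- Corrádi–Hajnal for the underlying simple graph.
triangle-partition : ∀ {k} (M : Multigraph (k * 3)) → Standard M → (∀ x → 4 * k ≤ suc (degree M x)) →
                     Σ (Fin k → Triple (k * 3)) λ T → Partition T × (∀ c → Triangle M (T c))
triangle-partition {k} M standard dense = T , partition , triangle
  where
  open Equitable (equitable-colouring {K = k} 3 k (non-adjacency M) (const true) (const true)
    (trans (sum-const k 1) (*-identityʳ k)) (trans (sum-const (k * 3) 1) (*-identityʳ (k * 3)))
    (λ x _ → non-adjacency-deg M standard dense x))
  members : ∀ c → Members (class colour c)
  members c = count≡3⇒members (class colour c) (sizes c refl)
  T : Fin k → Triple (k * 3)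
  T c = Members.x (members c) , Members.y (members c) , Members.z (members c)
  partition : Partition T
  partition φ = begin
    sum φ
      ≡⟨ sum-cong-≗ covered ⟩
    sum (λ v → maybe′ (const 1) 0 (colour v) * φ v)
      ≡⟨ ∑-classes colour (const 1) φ ⟨
    sum (λ c → 1 * Σ⟨ class colour c ⟩ φ)
      ≡⟨ sum-cong-≗ (λ c → trans (*-identityˡ _) (Members.all (members c) φ)) ⟩
    sum (λ c → ∑⟨ T c ⟩ φ) ∎
    where
    open ≡-Reasoning
    covered : ∀ v → φ v ≡ maybe′ (const 1) 0 (colour v) * φ v
    covered v with c , eq ← is-just-true (domain v) rewrite eq = sym (*-identityˡ (φ v))
  triangle : ∀ c → Triangle M (T c)
  triangle c = adjacent x≢y x∈ y∈ , adjacent y≢z y∈ z∈ , adjacent x≢z x∈ z∈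
    where
    open Members (members c)
    adjacent : ∀ {u v} → u ≢ v → class colour c u ≡ true → class colour c v ≡ true → Adjacent M u v
    adjacent u≢v u∈ v∈ = non-edge⇒adjacent M u≢v (proper (class-true⁻ colour u∈) (class-true⁻ colour v∈))

-- Exchanging vertices between two triangles

IsFourTriangle : Multigraph n → Triple n → Set
IsFourTriangle M (x , y , z) = FourTriangle M x y z

pigeonhole₃ : ∀ m {p q r} → 3 * m < p + q + r → m < p ⊎ m < q ⊎ m < r
pigeonhole₃ m {p} {q} {r} lt with suc m ≤? p | suc m ≤? q | suc m ≤? r
... | yes m<p | _       | _       = inj₁ m<p
... | no _    | yes m<q | _       = inj₂ (inj₁ m<q)
... | no _    | no _    | yes m<r = inj₂ (inj₂ m<r)
... | no m≮p  | no m≮q  | no m≮r  = contradiction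
  (≤-trans (+-mono-≤ (+-mono-≤ (≮⇒≥ m≮p) (≮⇒≥ m≮q)) (≮⇒≥ m≮r)) (≤-reflexive (triple m))) (<⇒≱ lt)
  where
  triple : ∀ m → m + m + m ≡ 3 * m
  triple = solve-∀

record Exchange (M : Multigraph n) (A B : Triple n) : Set where
  constructor exchanged
  field
    A′ B′  : Triple n
    four-A : IsFourTriangle M A′
    four-B : IsFourTriangle M B′
    same   : ∀ φ → ∑⟨ A′ ⟩ φ + ∑⟨ B′ ⟩ φ ≡ ∑⟨ A ⟩ φ + ∑⟨ B ⟩ φ

module _ {n} {M : Multigraph n} (standard : Standard M) where

  -- No pair carries more than 2 edges, so 3 edges from `x` must use both pairs; the edge `yz` is
  -- the fourth.
  four-triangle : ∀ {x y z} → Adjacent M y z → 3 ≤ μ M x y + μ M x z → FourTriangle M x y z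
  four-triangle {x} {y} {z} yz three =
    1≤ (standard x z) three , yz ,
    1≤ (standard x y) (≤-trans three (≤-reflexive (+-comm (μ M x y) (μ M x z)))) ,
    ≤-trans (+-mono-≤ three yz) (≤-reflexive (regroup (μ M x y) (μ M x z) (μ M y z)))
    where
    1≤ : ∀ {p q} → q ≤ 2 → 3 ≤ p + q → 1 ≤ p
    1≤ {zero}  q≤2 3≤q = contradiction (≤-trans 3≤q q≤2) λ { (s≤s (s≤s ())) }
    1≤ {suc _} _   _   = s≤s z≤n
    regroup : ∀ p q r → p + q + r ≡ p + r + q
    regroup = solve-∀

  -- The vertices `x` and `a` change places. At most 2 of the 5 edges at `x` go to `a`, so 3 remain
  -- for `b` and `c`.
  swap-vertices : ∀ {x y z a b c} → Adjacent M y z → Adjacent M b c →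
                  5 ≤ ∑⟨ a , b , c ⟩ (μ M x) → 3 ≤ μ M y a + μ M z a → Exchange M (x , y , z) (a , b , c)
  swap-vertices {x} {y} {z} {a} {b} {c} yz bc five three = exchanged (a , y , z) (x , b , c)
    (four-triangle yz (≤-trans three (≤-reflexive (cong₂ _+_ (μ-sym M y a) (μ-sym M z a)))))
    (four-triangle bc (+-cancelˡ-≤ 2 3 _ (≤-trans five (≤-trans (≤-reflexive (+-assoc (μ M x a) _ _))
      (+-monoˡ-≤ _ (standard x a))))))
    λ φ → regroup (φ x) (φ y) (φ z) (φ a) (φ b) (φ c)
    where
    regroup : ∀ x y z a b c → a + y + z + (x + b + c) ≡ x + y + z + (a + b + c)
    regroup = solve-∀

  permute : ∀ {A A₁ B B₁} → (∀ φ → ∑⟨ A ⟩ φ ≡ ∑⟨ A₁ ⟩ φ) → (∀ φ → ∑⟨ B ⟩ φ ≡ ∑⟨ B₁ ⟩ φ) →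
            Exchange M A B → Exchange M A₁ B₁
  permute A~A₁ B~B₁ (exchanged A′ B′ fA fB same) =
    exchanged A′ B′ fA fB λ φ → trans (same φ) (cong₂ _+_ (A~A₁ φ) (B~B₁ φ))

  rotate-second : ∀ p q r → q + p + r ≡ p + q + r
  rotate-second = solve-∀

  rotate-third : ∀ p q r → r + p + q ≡ p + q + r
  rotate-third = solve-∀

  exchange-from : ∀ {x y z a b c} → Adjacent M y z → Triangle M (a , b , c) → 5 ≤ ∑⟨ a , b , c ⟩ (μ M x) →
                  13 ≤ ∑⟨ a , b , c ⟩ (μ M x) + ∑⟨ a , b , c ⟩ (μ M y) + ∑⟨ a , b , c ⟩ (μ M z) →
                  Exchange M (x , y , z) (a , b , c)
  exchange-from {x} {y} {z} {a} {b} {c} yz (ab , bc , ac) five thirteen = cases (pigeonhole₃ 2 seven)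
    where
    regroup : ∀ r p q s t u v → r + (p + q + s) + (t + u + v) ≡ r + ((p + t) + (q + u) + (s + v))
    regroup = solve-∀
    -- The vertex `x` accounts for at most 6 of the 13 edges.
    seven : 7 ≤ (μ M y a + μ M z a) + (μ M y b + μ M z b) + (μ M y c + μ M z c)
    seven = +-cancelˡ-≤ 6 7 _ (≤-trans thirteen (≤-trans
      (≤-reflexive (regroup (∑⟨ a , b , c ⟩ (μ M x)) (μ M y a) (μ M y b) (μ M y c) (μ M z a) (μ M z b) (μ M z c)))
      (+-monoˡ-≤ _ (+-mono-≤ (+-mono-≤ (standard x a) (standard x b)) (standard x c)))))
    cases : 3 ≤ μ M y a + μ M z a ⊎ 3 ≤ μ M y b + μ M z b ⊎ 3 ≤ μ M y c + μ M z c →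
            Exchange M (x , y , z) (a , b , c)
    cases (inj₁ p) = swap-vertices yz bc five p
    cases (inj₂ (inj₁ p)) = permute (λ _ → refl) (λ φ → rotate-second (φ a) (φ b) (φ c))
      (swap-vertices yz ac (≤-trans five (≤-reflexive (sym (rotate-second (μ M x a) (μ M x b) (μ M x c))))) p)
    cases (inj₂ (inj₂ p)) = permute (λ _ → refl) (λ φ → rotate-third (φ a) (φ b) (φ c))
      (swap-vertices yz ab (≤-trans five (≤-reflexive (sym (rotate-third (μ M x a) (μ M x b) (μ M x c))))) p)

  -- Some x in A sends at least 5 edges to B, so x with any two vertices of B is a
  -- 4-triangle; the other two vertices of A send at least 7, so at least 3 to some a in B.
  thirteen⇒exchange : ∀ {A B} → Triangle M A → Triangle M B →
                      13 ≤ ∑⟨ A ⟩ (λ x → ∑⟨ B ⟩ (μ M x)) → Exchange M A B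
  thirteen⇒exchange {x , y , z} {B} (xy , yz , xz) tB thirteen = cases (pigeonhole₃ 4 thirteen)
    where
    r : Fin n → ℕ
    r u = ∑⟨ B ⟩ (μ M u)
    cases : 5 ≤ r x ⊎ 5 ≤ r y ⊎ 5 ≤ r z → Exchange M (x , y , z) B
    cases (inj₁ p) = exchange-from yz tB p thirteen
    cases (inj₂ (inj₁ p)) = permute (λ φ → rotate-second (φ x) (φ y) (φ z)) (λ _ → refl)
      (exchange-from xz tB p (≤-trans thirteen (≤-reflexive (sym (rotate-second (r x) (r y) (r z))))))
    cases (inj₂ (inj₂ p)) = permute (λ φ → rotate-third (φ x) (φ y) (φ z)) (λ _ → refl)
      (exchange-from xy tB p (≤-trans thirteen (≤-reflexive (sym (rotate-third (r x) (r y) (r z))))))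

triangle⇒four : ∀ (M : Multigraph n) {A} → Triangle M A → 4 ≤ weight M A → IsFourTriangle M A
triangle⇒four M (p , q , r) four = p , q , r , four

four⇒triangle : ∀ (M : Multigraph n) {A} → IsFourTriangle M A → Triangle M A
four⇒triangle M (p , q , r , _) = p , q , r

four⇒weight : ∀ (M : Multigraph n) {A} → IsFourTriangle M A → 4 ≤ weight M A
four⇒weight M (_ , _ , _ , four) = four

-- Every edge of the triangle is counted from both ends.
internal-degree : ∀ (M : Multigraph n) A → ∑⟨ A ⟩ (λ x → ∑⟨ A ⟩ (μ M x)) ≡ 2 * weight M A
internal-degree M (x , y , z)
  rewrite μ-loop M x | μ-loop M y | μ-loop M z | μ-sym M y x | μ-sym M z x | μ-sym M z y =
  regroup (μ M x y) (μ M y z) (μ M x z)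
  where
  regroup : ∀ p q r → p + r + (p + 0 + q) + (r + q + 0) ≡ 2 * (p + q + r)
  regroup = solve-∀

sum-≔ : ∀ (f : Fin n → ℕ) v x → sum (f [ v ≔ x ]) + f v ≡ sum f + x
sum-≔ f v x = trans (sum-differ (f [ v ≔ x ]) f v (λ u → ≔-other f)) (cong (sum f +_) (≔-same f v))

∑-≔ : ∀ {k} (T : Fin k → Triple n) c A φ d → ∑⟨ (T [ c ≔ A ]) d ⟩ φ ≡ ((λ d → ∑⟨ T d ⟩ φ) [ c ≔ ∑⟨ A ⟩ φ ]) d
∑-≔ T c A φ d with d Fin.≟ c
... | yes _ = refl
... | no _  = refl

module Exchanging {n k} {M : Multigraph n} (T : Fin k → Triple n) {c d} (d≢c : d ≢ c)
                  (exchange : Exchange M (T c) (T d)) where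

  open Exchange exchange

  T₁ T₂ : Fin k → Triple n
  T₁ = T [ c ≔ A′ ]
  T₂ = T₁ [ d ≔ B′ ]

  four : ∀ e → e ≡ c ⊎ e ≡ d → IsFourTriangle M (T₂ e)
  four e p with e Fin.≟ d | e Fin.≟ c
  four e p        | yes _  | _      = four-B
  four e p        | no _   | yes _  = four-A
  four e (inj₁ p) | no _   | no ¬p  = contradiction p ¬p
  four e (inj₂ p) | no ¬p  | no _   = contradiction p ¬p

  preserves : ∀ {P : Triple n → Set} → (∀ {A} → IsFourTriangle M A → P A) → (∀ e → P (T e)) → ∀ e → P (T₂ e)
  preserves four⇒P all e with e Fin.≟ d | e Fin.≟ c
  ... | yes _ | _     = four⇒P four-B
  ... | no _  | yes _ = four⇒P four-A
  ... | no _  | no _  = all e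

  unchanged : ∀ {e} → e ≢ c → e ≢ d → T₂ e ≡ T e
  unchanged e≢c e≢d = trans (≔-other T₁ e≢d) (≔-other T e≢c)

  -- The triples are replaced one at a time; `d ≢ c` ensures that the second replacement still
  -- removes the original `T d`.
  partition : Partition T → Partition T₂
  partition part φ = trans (part φ) (+-cancelʳ-≡ (∑⟨ T c ⟩ φ + ∑⟨ T d ⟩ φ) _ _ (begin
    sum ∑T + (∑⟨ T c ⟩ φ + ∑⟨ T d ⟩ φ)
      ≡⟨ cong (sum ∑T +_) (same φ) ⟨
    sum ∑T + (∑⟨ A′ ⟩ φ + ∑⟨ B′ ⟩ φ)
      ≡⟨ +-assoc (sum ∑T) _ _ ⟨
    sum ∑T + ∑⟨ A′ ⟩ φ + ∑⟨ B′ ⟩ φ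
      ≡⟨ cong (_+ ∑⟨ B′ ⟩ φ) (sum-≔ ∑T c (∑⟨ A′ ⟩ φ)) ⟨
    sum (∑T [ c ≔ ∑⟨ A′ ⟩ φ ]) + ∑⟨ T c ⟩ φ + ∑⟨ B′ ⟩ φ
      ≡⟨ cong (λ s → s + ∑⟨ T c ⟩ φ + ∑⟨ B′ ⟩ φ) (sum-cong-≗ (∑-≔ T c A′ φ)) ⟨
    sum ∑T₁ + ∑⟨ T c ⟩ φ + ∑⟨ B′ ⟩ φ
      ≡⟨ regroup (sum ∑T₁) (∑⟨ T c ⟩ φ) (∑⟨ B′ ⟩ φ) ⟩
    ∑⟨ T c ⟩ φ + (sum ∑T₁ + ∑⟨ B′ ⟩ φ)
      ≡⟨ cong (∑⟨ T c ⟩ φ +_) (sum-≔ ∑T₁ d (∑⟨ B′ ⟩ φ)) ⟨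
    ∑⟨ T c ⟩ φ + (sum (∑T₁ [ d ≔ ∑⟨ B′ ⟩ φ ]) + ∑T₁ d)
      ≡⟨ cong₂ (λ s t → ∑⟨ T c ⟩ φ + (s + t)) (sum-cong-≗ (∑-≔ T₁ d B′ φ))
           (cong (λ A → ∑⟨ A ⟩ φ) (sym (≔-other T d≢c))) ⟨
    ∑⟨ T c ⟩ φ + (sum (λ e → ∑⟨ T₂ e ⟩ φ) + ∑⟨ T d ⟩ φ)
      ≡⟨ regroup′ (∑⟨ T c ⟩ φ) (sum (λ e → ∑⟨ T₂ e ⟩ φ)) (∑⟨ T d ⟩ φ) ⟩
    sum (λ e → ∑⟨ T₂ e ⟩ φ) + (∑⟨ T c ⟩ φ + ∑⟨ T d ⟩ φ) ∎))
    where
    open ≡-Reasoning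
    ∑T ∑T₁ : Fin k → ℕ
    ∑T e = ∑⟨ T e ⟩ φ
    ∑T₁ e = ∑⟨ T₁ e ⟩ φ
    regroup : ∀ s a b → s + a + b ≡ a + (s + b)
    regroup = solve-∀
    regroup′ : ∀ a s b → a + (s + b) ≡ s + (a + b)
    regroup′ = solve-∀

-- Increasing the number of 4-triangles

module Improvement {k} (M : Multigraph (k * 3)) (standard : Standard M)
                   (dense : ∀ x → 4 * k ≤ suc (degree M x)) where

  FourTrianglePartition : Set
  FourTrianglePartition = Σ (Fin k → Triple (k * 3)) λ T → Partition T × (∀ c → IsFourTriangle M (T c))

  light : (Fin k → Triple (k * 3)) → Fin k → Bool
  light T c = not (does (4 ≤? weight M (T c)))

  light-false : ∀ T c → IsFourTriangle M (T c) → light T c ≡ false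
  light-false T c four = cong not (dec-true (4 ≤? weight M (T c)) (four⇒weight M {T c} four))

  light-true : ∀ T c → ¬ 4 ≤ weight M (T c) → light T c ≡ true
  light-true T c ¬four = cong not (dec-false (4 ≤? weight M (T c)) ¬four)

  edges : (Fin k → Triple (k * 3)) → Fin k → Fin k → ℕ
  edges T c d = ∑⟨ T c ⟩ (λ x → ∑⟨ T d ⟩ (μ M x))

  sum-edges : ∀ T → Partition T → ∀ c → sum (edges T c) ≡ ∑⟨ T c ⟩ (degree M)
  sum-edges T partition c = expand (T c)
    where
    expand : ∀ A → sum (λ d → ∑⟨ A ⟩ (λ x → ∑⟨ T d ⟩ (μ M x))) ≡ ∑⟨ A ⟩ (degree M)
    expand (x , y , z) = trans (sum-+ (λ d → ∑⟨ T d ⟩ (μ M x) + ∑⟨ T d ⟩ (μ M y)) (λ d → ∑⟨ T d ⟩ (μ M z)))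
      (cong₂ _+_ (trans (sum-+ (λ d → ∑⟨ T d ⟩ (μ M x)) (λ d → ∑⟨ T d ⟩ (μ M y)))
        (cong₂ _+_ (sym (partition (μ M x))) (sym (partition (μ M y))))) (sym (partition (μ M z))))

  -- The degrees in a triple sum to at least `3 * (4k - 1) = 12k - 3`. The thresholds are 12 for
  -- every other triple and 6 for the triple itself, the internal count of a triangle of weight 3;
  -- together they make only `12k - 6`.
  many-edges : ∀ T → Partition T → ∀ c → sum (const 12 [ c ≔ 6 ]) < sum (edges T c)
  many-edges T partition c = +-cancelʳ-≤ 12 _ _ (begin
    suc (sum (const 12 [ c ≔ 6 ])) + 12   ≡⟨ cong suc (trans (sum-≔ (const 12) c 6) (cong (_+ 6) (sum-const k 12))) ⟩
    suc (k * 12 + 6)                      ≤⟨ +-monoʳ-≤ (suc (k * 12)) (m≤m+n 6 2) ⟩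
    suc (k * 12 + 8)                      ≡⟨ rearrange k ⟩
    4 * k + 4 * k + 4 * k + 9             ≤⟨ degrees (T c) ⟩
    ∑⟨ T c ⟩ (degree M) + 12              ≡⟨ cong (_+ 12) (sum-edges T partition c) ⟨
    sum (edges T c) + 12                  ∎)
    where
    open ≤-Reasoning
    rearrange : ∀ k → suc (k * 12 + 8) ≡ 4 * k + 4 * k + 4 * k + 9
    rearrange = solve-∀
    rearrange′ : ∀ p q r → suc p + suc q + suc r + 9 ≡ p + q + r + 12
    rearrange′ = solve-∀
    degrees : ∀ A → 4 * k + 4 * k + 4 * k + 9 ≤ ∑⟨ A ⟩ (degree M) + 12
    degrees (x , y , z) = ≤-trans (+-monoˡ-≤ 9 (+-mono-≤ (+-mono-≤ (dense x) (dense y)) (dense z)))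
      (≤-reflexive (rearrange′ (degree M x) (degree M y) (degree M z)))

  partner : ∀ T → Partition T → ∀ {c} → ¬ 4 ≤ weight M (T c) → ∃ λ d → d ≢ c × 13 ≤ edges T c d
  partner T partition {c} ¬four = check (sum<⇒∃< (edges T c) (const 12 [ c ≔ 6 ]) (many-edges T partition c))
    where
    edges-c : edges T c c ≤ 6
    edges-c = ≤-trans (≤-reflexive (internal-degree M (T c))) (*-monoʳ-≤ 2 (s≤s⁻¹ (≰⇒> ¬four)))
    check : (∃ λ d → (const 12 [ c ≔ 6 ]) d < edges T c d) → ∃ λ d → d ≢ c × 13 ≤ edges T c d
    check (d , lt) = d , d≢c , subst (_< edges T c d) (≔-other (const 12) d≢c) lt
      where
      d≢c : d ≢ c
      d≢c refl = contradiction (subst (_< edges T c c) (≔-same (const 12) c) lt) (≤⇒≯ edges-c)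

  improve : ∀ T → Partition T → (∀ c → Triangle M (T c)) → Acc _<_ (count (light T)) → FourTrianglePartition
  improve T partition triangle (acc rec) = decide (Fin.any? λ c → ¬? (4 ≤? weight M (T c)))
    where
    decide : Dec (∃ λ c → ¬ 4 ≤ weight M (T c)) → FourTrianglePartition
    decide (no none) = T , partition , λ c → triangle⇒four M {T c} (triangle c) (decidable-stable (4 ≤? _) (none ∘ (c ,_)))
    decide (yes (c , ¬four)) = exchange-with (partner T partition ¬four)
      where
      exchange-with : (∃ λ d → d ≢ c × 13 ≤ edges T c d) → FourTrianglePartition
      exchange-with (d , d≢c , thirteen) = improve T₂ (E.partition partition) triangle₂ (rec fewer)
        where
        module E = Exchanging {M = M} T d≢c (thirteen⇒exchange standard (triangle c) (triangle d) thirteen)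
        open E using (T₂; four; unchanged)
        triangle₂ : ∀ e → Triangle M (T₂ e)
        triangle₂ = E.preserves {P = Triangle M} (λ {A} → four⇒triangle M {A}) triangle
        fewer : count (light T₂) < count (light T)
        fewer = count-< ⊆ (light-false T₂ c (four c (inj₁ refl))) (light-true T c ¬four)
          where
          heavy : ∀ {e} → light T₂ e ≡ true → e ≡ c ⊎ e ≡ d → ⊥
          heavy {e} l p = true≢false l (light-false T₂ e (four e p))
          ⊆ : ∀ e → light T₂ e ≡ true → light T e ≡ true
          ⊆ e l = trans (cong (λ A → not (does (4 ≤? weight M A))) (sym (unchanged (heavy l ∘ inj₁) (heavy l ∘ inj₂)))) l

  four-triangle-partition : FourTrianglePartition
  four-triangle-partition =
    let T , partition , triangle = triangle-partition M standard dense
    in improve T partition triangle (<-wellFounded _)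

-- Packings, and the residue of n modulo 3

record Packing (M : Multigraph n) (k : ℕ) : Set where
  constructor packing
  field
    triple   : Fin k → Triple n
    four     : ∀ c → IsFourTriangle M (triple c)
    disjoint : ∀ {c d v} → c ≢ d → v ∈ verts (triple c) → v ∉ verts (triple d)

-- Test the partition on the indicator of `v`: its total is 1, but two triples containing `v` would
-- contribute 2.
partition⇒disjoint : ∀ {n k} (T : Fin k → Triple n) → Partition T →
                     ∀ {c d v} → c ≢ d → v ∈ verts (T c) → v ∉ verts (T d)
partition⇒disjoint T partition {c} {d} {v} c≢d v∈c v∈d = contradiction
  (begin
    2                                 ≤⟨ +-mono-≤ (hit (T c) v∈c) (hit (T d) v∈d) ⟩
    ∑⟨ T c ⟩ φ + ∑⟨ T d ⟩ φ           ≤⟨ two-terms≤sum (λ e → ∑⟨ T e ⟩ φ) c≢d ⟩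
    sum (λ e → ∑⟨ T e ⟩ φ)            ≡⟨ partition φ ⟨
    sum φ                             ≡⟨ count-at v ⟩
    1                                 ∎) λ { (s≤s ()) }
  where
  open ≤-Reasoning
  φ : Fin _ → ℕ
  φ u = 𝟙 (does (u Fin.≟ v))
  φv : 1 ≤ φ v
  φv = ≤-reflexive (cong 𝟙 (sym (dec-true (v Fin.≟ v) refl)))
  hit : ∀ A → v ∈ verts A → 1 ≤ ∑⟨ A ⟩ φ
  hit (x , y , z) (here refl)                 = ≤-trans φv (≤-trans (m≤m+n (φ v) (φ y)) (m≤m+n _ (φ z)))
  hit (x , y , z) (there (here refl))         = ≤-trans φv (≤-trans (m≤n+m (φ v) (φ x)) (m≤m+n _ (φ z)))
  hit (x , y , z) (there (there (here refl))) = ≤-trans φv (m≤n+m (φ v) (φ x + φ y))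

Packing-divisible : ∀ {k} (M : Multigraph (k * 3)) → Standard M → (∀ x → 4 * k ≤ suc (degree M x)) → Packing M k
Packing-divisible M standard dense =
  let T , partition , four = Improvement.four-triangle-partition M standard dense
  in packing T four (partition⇒disjoint T partition)

adjacent⇒≢ : ∀ (M : Multigraph n) {x y} → Adjacent M x y → x ≢ y
adjacent⇒≢ M {x} adj refl with () ← subst (1 ≤_) (μ-loop M x) adj

Packing⇒list : ∀ {M : Multigraph n} {k} → Packing M k →
               Σ (List (Triple n)) (λ ts → length ts ≡ k × DisjointFourTriangles M ts)
Packing⇒list {M = M} (packing T four disjoint) =
  tabulate T , length-tabulate T , All.tabulate⁺ four ,
  AllPairs.concat⁺ (All.map⁺ (All.tabulate⁺ λ c → distinct (four c)))
    (AllPairs.map⁺ (AllPairs.tabulate⁺ λ c≢d → All.tabulate λ u∈ → All.tabulate λ v∈ → λ { refl → disjoint c≢d u∈ v∈ }))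
  where
  distinct : ∀ {A} → IsFourTriangle M A → AllPairs _≢_ (verts A)
  distinct (xy , yz , xz , _) =
    (adjacent⇒≢ M xy ∷ adjacent⇒≢ M xz ∷ []) ∷ (adjacent⇒≢ M yz ∷ []) ∷ [] ∷ []

sucs : Triple n → Triple (suc n)
sucs (x , y , z) = suc x , suc y , suc z

∈-sucs : ∀ {v} {A : Triple n} → suc v ∈ verts (sucs A) → v ∈ verts A
∈-sucs (here refl)                 = here refl
∈-sucs (there (here refl))         = there (here refl)
∈-sucs (there (there (here refl))) = there (there (here refl))

sucs-∈ : ∀ {v} {A : Triple n} → v ∈ verts A → suc v ∈ verts (sucs A)
sucs-∈ (here refl)                 = here refl
sucs-∈ (there (here refl))         = there (here refl)
sucs-∈ (there (there (here refl))) = there (there (here refl))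

0∉sucs : ∀ {A : Triple n} → zero ∉ verts (sucs A)
0∉sucs (here ())
0∉sucs (there (here ()))
0∉sucs (there (there (here ())))

tail : Multigraph (suc n) → Multigraph n
tail M = record
  { μ = λ x y → μ M (suc x) (suc y) ; μ-sym = λ x y → μ-sym M (suc x) (suc y) ; μ-loop = λ x → μ-loop M (suc x) }

Packing-tail : ∀ {M : Multigraph (suc n)} {k} → Packing (tail M) k → Packing M k
Packing-tail {n} (packing T four disjoint) = packing (sucs ∘ T) four λ {c} {d} → disjoint′ {c} {d}
  where
  disjoint′ : ∀ {c d v} → c ≢ d → v ∈ verts (sucs (T c)) → v ∉ verts (sucs (T d))
  disjoint′ {v = zero}  c≢d v∈ _  = 0∉sucs v∈
  disjoint′ {v = suc v} c≢d v∈ v∈′ = disjoint c≢d (∈-sucs v∈) (∈-sucs v∈′)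

cone : Multigraph n → Multigraph (suc n)
cone {n} M = record { μ = μ′ ; μ-sym = μ′-sym ; μ-loop = μ′-loop }
  where
  μ′ : Fin (suc n) → Fin (suc n) → ℕ
  μ′ zero    zero    = 0
  μ′ zero    (suc _) = 2
  μ′ (suc _) zero    = 2
  μ′ (suc x) (suc y) = μ M x y
  μ′-sym : ∀ x y → μ′ x y ≡ μ′ y x
  μ′-sym zero    zero    = refl
  μ′-sym zero    (suc _) = refl
  μ′-sym (suc _) zero    = refl
  μ′-sym (suc x) (suc y) = μ-sym M x y
  μ′-loop : ∀ x → μ′ x x ≡ 0
  μ′-loop zero    = refl
  μ′-loop (suc x) = μ-loop M x

cone-standard : ∀ (M : Multigraph n) → Standard M → Standard (cone M)
cone-standard M standard zero    zero    = z≤n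
cone-standard M standard zero    (suc _) = ≤-refl
cone-standard M standard (suc _) zero    = ≤-refl
cone-standard M standard (suc x) (suc y) = standard x y

≢0⇒sucs : ∀ (A : Triple (suc n)) → zero ∉ verts A → ∃ λ B → A ≡ sucs B
≢0⇒sucs (zero , _ , _)           0∉ = contradiction (here refl) 0∉
≢0⇒sucs (suc _ , zero , _)       0∉ = contradiction (there (here refl)) 0∉
≢0⇒sucs (suc _ , suc _ , zero)   0∉ = contradiction (there (there (here refl))) 0∉
≢0⇒sucs (suc x , suc y , suc z)  _  = (x , y , z) , refl

-- By disjointness at most one triple contains the apex `zero`; once it is dropped, the other `k`
-- lie in `M`.
Packing-cone : ∀ {M : Multigraph n} {k} → Packing (cone M) (suc k) → Packing M k
Packing-cone {n} {M} {k} (packing T four disjoint) = packing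
  (proj₁ ∘ below)
  (λ i → subst (IsFourTriangle (cone M)) (proj₂ (below i)) (four (punchIn (proj₁ apex) i)))
  λ {i} {j} i≢j v∈ v∈′ → disjoint (i≢j ∘ Fin.punchIn-injective (proj₁ apex) i j) (lift i v∈) (lift j v∈′)
  where
  apex : ∃ λ c₀ → ∀ c → c ≢ c₀ → zero ∉ verts (T c)
  apex with Fin.any? (λ c → zero ∈? verts (T c))
  ... | yes (c₀ , 0∈) = c₀ , λ c c≢c₀ 0∈′ → disjoint c≢c₀ 0∈′ 0∈
  -- If no triple contains the apex, any one of them may be dropped.
  ... | no none       = zero , λ c _ 0∈ → none (c , 0∈)
  below : ∀ i → ∃ λ B → T (punchIn (proj₁ apex) i) ≡ sucs B
  below i = ≢0⇒sucs _ (proj₂ apex _ (Fin.punchInᵢ≢i (proj₁ apex) i))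
  lift : ∀ i {v} → v ∈ verts (proj₁ (below i)) → suc v ∈ verts (T (punchIn (proj₁ apex) i))
  lift i {v} v∈ = subst (λ A → suc v ∈ verts A) (sym (proj₂ (below i))) (sucs-∈ v∈)

-- Integrality absorbs the remainder 2; this rounding pays for the deleted vertex below.
divide-by-3 : ∀ {m n} → 3 * m ≤ 2 + 3 * n → m ≤ n
divide-by-3 {m} {n} le with m ≤? n
... | yes m≤n = m≤n
... | no m≰n = contradiction (≤-trans (*-monoʳ-≤ 3 (≰⇒> m≰n)) le) (<⇒≱ (≤-reflexive (identity n)))
  where
  identity : ∀ n → suc (2 + 3 * n) ≡ 3 * suc n
  identity = solve-∀

-- The degree bound `(4n - 3) / 3`, cleared of both division and subtraction.
Dense : Multigraph n → Set
Dense {n} M = ∀ x → 4 * n ≤ 3 + 3 * degree M x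

Packing-⌊n/3⌋ : ∀ {n} k (r : Fin 3) → n ≡ toℕ r + k * 3 → (M : Multigraph n) → Standard M → Dense M → Packing M k
Packing-⌊n/3⌋ k zero refl M standard dense = Packing-divisible M standard λ x →
  divide-by-3 (≤-trans (≤-reflexive (e₁ k)) (≤-trans (dense x) (≤-trans (≤-reflexive (e₂ (degree M x))) (m≤n+m _ 2))))
  where
  e₁ : ∀ k → 3 * (4 * k) ≡ 4 * (k * 3)
  e₁ = solve-∀
  e₂ : ∀ d → 3 + 3 * d ≡ 3 * suc d
  e₂ = solve-∀
-- The deletion costs each vertex at most 2. From `12k + 4 ≤ 3 + 3(d + 2)` follows
-- `12k ≤ 2 + 3(d + 1)`, which rounds down to `4k ≤ d + 1`.
Packing-⌊n/3⌋ k (suc zero) refl M standard dense = Packing-tail {M = M}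
  (Packing-divisible (tail M) (λ x y → standard (suc x) (suc y)) λ x →
    divide-by-3 (+-cancelˡ-≤ 4 _ _ (≤-trans (≤-reflexive (e₁ k)) (≤-trans (dense (suc x))
      (≤-trans (+-monoʳ-≤ 3 (*-monoʳ-≤ 3 (+-monoˡ-≤ (degree (tail M) x) (standard (suc x) zero))))
        (≤-reflexive (e₂ (degree (tail M) x))))))))
  where
  e₁ : ∀ k → 4 + 3 * (4 * k) ≡ 4 * suc (k * 3)
  e₁ = solve-∀
  e₂ : ∀ d → 3 + 3 * (2 + d) ≡ 4 + (2 + 3 * suc d)
  e₂ = solve-∀
-- Each old vertex gains 2, enough for the bound with `k + 1`; the apex has degree `6k + 4`, which
-- is at least `4(k + 1) - 1`.
Packing-⌊n/3⌋ k (suc (suc zero)) refl M standard dense = Packing-cone {M = M}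
  (Packing-divisible {suc k} (cone M) (cone-standard M standard) dense′)
  where
  dense′ : ∀ x → 4 * suc k ≤ suc (degree (cone M) x)
  dense′ zero = ≤-trans (m≤n+m _ (2 * k + 1)) (≤-reflexive
    (trans (e₁ k) (cong suc (sym (sum-const (2 + k * 3) 2)))))
    where
    e₁ : ∀ k → 2 * k + 1 + 4 * suc k ≡ suc ((2 + k * 3) * 2)
    e₁ = solve-∀
  dense′ (suc x) = divide-by-3 (≤-trans (≤-reflexive (e₁ k)) (≤-trans (+-monoʳ-≤ 4 (dense x))
    (≤-trans (m≤n+m _ 4) (≤-reflexive (e₂ (degree M x))))))
    where
    e₁ : ∀ k → 3 * (4 * suc k) ≡ 4 + 4 * (2 + k * 3)
    e₁ = solve-∀
    e₂ : ∀ d → 4 + (4 + (3 + 3 * d)) ≡ 2 + 3 * suc (2 + d)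
    e₂ = solve-∀

theorem11 : (n : ℕ) (M : Multigraph n) → Standard M →
    (∀ (x : Fin n) → 4 * n ∸ 3 ≤ 3 * degree M x) →
    Σ (List (Triple n)) (λ ts → length ts ≡ n / 3 × DisjointFourTriangles M ts)
theorem11 n M standard dense = Packing⇒list
  (Packing-⌊n/3⌋ (n / 3) (n mod 3) (DivMod.property (n divMod 3)) M standard
    -- The inequality `4 * n ≤ 3 + (4 * n ∸ 3)` holds even where the subtraction truncates.
    λ x → ≤-trans (m≤n+m∸n (4 * n) 3) (+-monoʳ-≤ 3 (dense x)))
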